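{- Let $t\in\{1,2,3\}$ and let $n$ be a positive integer such that a real Hadamard matrix of order $4n$ exists; if $t=3$ assume $n\ge 4$. Put $\rho_1=\tfrac12$, $\rho_2=2$, $\rho_3=4$. Then there exists a real $\epsilon$-Hadamard matrix of order $4n-t$ with $$\epsilon \le \frac{\rho_t}{\sqrt{n}}.$$
   Context: A real Hadamard matrix of order $m$ is an $m\times m$ matrix with entries $\pm1$ whose rows are pairwise orthogonal (equivalently, $\frac1{\sqrt m}$ times it is orthogonal). A real orthogonal $k\times k$ matrix $O$ is called an $\epsilon$-Hadamard matrix of order $k$ if, writing the absolute value of each entry as $|O_{ij}| = \frac{1+\epsilon_{ij}}{\sqrt{k}}$, one has $\epsilon=\max_{i,j}|\epsilon_{ij}|<1$ (and, as $k$ varies in a family, $\epsilon_{ij}=\pm O(k^{ -\lambda})$ for some $\lambda>0$). -}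

module Defs where

open import Algebra.Bundles using (CommutativeRing)
import Algebra.Properties.CommutativeMonoid.Sum as Sum
open import Algebra.Structures using (IsCommutativeRing)
open import Data.Fin.Base using (Fin; zero; suc)
import Data.Fin.Properties as Fin
open import Data.Integer.Base as ℤ using (ℤ; +_; 0ℤ; 1ℤ; -1ℤ)
import Data.Integer.Properties as ℤ
import Data.Integer.Solver as ℤSolver
open import Data.Nat.Base as ℕ using (ℕ; zero; suc; NonZero)
import Data.Nat.Properties as ℕ
open import Data.Nat.Solver using (module +-*-Solver)
open import Data.Product.Base using (∃; _×_; _,_; proj₁; proj₂)
open import Data.Rational.Base as ℚ using (ℚ; 0ℚ; 1ℚ; ½; mkℚ)
import Data.Rational.Properties as ℚ
import Data.Rational.Solver as ℚSolver
import Data.Rational.Unnormalised.Base as ℚᵘ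
import Data.Rational.Unnormalised.Properties as ℚᵘ
open import Data.Sum.Base using (_⊎_; inj₁; inj₂)
open import Data.Vec.Functional using (Vector; foldr)
open import Function.Base using (_∘_)
open import Level using (0ℓ)
open import Relation.Binary.PropositionalEquality
open import Relation.Nullary using (yes; no; contradiction)

module ℚS = ℚSolver.+-*-Solver

opaque
  ≤-resp-≡ˡ : ∀ {p q r} → p ≡ q → p ℚ.≤ r → q ℚ.≤ r
  ≤-resp-≡ˡ refl p≤r = p≤r

  ≤-resp-≡ʳ : ∀ {p q r} → p ≡ q → r ℚ.≤ p → r ℚ.≤ q
  ≤-resp-≡ʳ refl r≤p = r≤p

  <-resp-≡ˡ : ∀ {p q r} → p ≡ q → p ℚ.< r → q ℚ.< r
  <-resp-≡ˡ refl p<r = p<r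

  <-resp-≡ʳ : ∀ {p q r} → p ≡ q → r ℚ.< p → r ℚ.< q
  <-resp-≡ʳ refl r<p = r<p

  pos½ : ∀ {ε} → 0ℚ ℚ.< ε → 0ℚ ℚ.< ½ ℚ.* ε
  pos½ {ε} ε>0 = ℚ.positive⁻¹ (½ ℚ.* ε) {{ℚ.pos*pos⇒pos ½ ε {{ℚ.positive ε>0}}}}

  pos* : ∀ {p q} → 0ℚ ℚ.< p → 0ℚ ℚ.< q → 0ℚ ℚ.< p ℚ.* q
  pos* {p} {q} p>0 q>0 =
    ℚ.positive⁻¹ (p ℚ.* q) {{ℚ.pos*pos⇒pos p {{ℚ.positive p>0}} q {{ℚ.positive q>0}}}}

  halves : ∀ ε → ½ ℚ.* ε ℚ.+ ½ ℚ.* ε ≡ ε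
  halves ε = trans (sym (ℚ.*-distribʳ-+ ε ½ ½)) (ℚ.*-identityˡ ε)

  halves-< : ∀ {p q ε} → p ℚ.< ½ ℚ.* ε → q ℚ.< ½ ℚ.* ε → p ℚ.+ q ℚ.< ε
  halves-< {ε = ε} p< q< = <-resp-≡ʳ (halves ε) (ℚ.+-mono-< p< q<)

  p≤∣p∣ : ∀ p → p ℚ.≤ ℚ.∣ p ∣
  p≤∣p∣ p with ℚ.≤-total 0ℚ p
  ... | inj₁ 0≤p = ℚ.≤-reflexive (sym (ℚ.0≤p⇒∣p∣≡p 0≤p))
  ... | inj₂ p≤0 = ℚ.≤-trans p≤0 (ℚ.0≤∣p∣ p)

  ∣∣-lub : ∀ {p q} → p ℚ.≤ q → ℚ.- p ℚ.≤ q → ℚ.∣ p ∣ ℚ.≤ q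
  ∣∣-lub {p} p≤q -p≤q with ℚ.∣p∣≡p∨∣p∣≡-p p
  ... | inj₁ eq = ≤-resp-≡ˡ (sym eq) p≤q
  ... | inj₂ eq = ≤-resp-≡ˡ (sym eq) -p≤q

  dist-refl : ∀ p → ℚ.∣ p ℚ.- p ∣ ≡ 0ℚ
  dist-refl p = cong ℚ.∣_∣ (ℚ.+-inverseʳ p)

  neg-sub : ∀ p q → ℚ.- (p ℚ.- q) ≡ q ℚ.- p
  neg-sub = ℚS.solve 2 (λ p q → ℚS.:- (p ℚS.:- q) ℚS.:= q ℚS.:- p) refl

  dist-sym : ∀ p q → ℚ.∣ p ℚ.- q ∣ ≡ ℚ.∣ q ℚ.- p ∣
  dist-sym p q = trans (sym (ℚ.∣-p∣≡∣p∣ (p ℚ.- q))) (cong ℚ.∣_∣ (neg-sub p q))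

  dist-trans : ∀ p q r → ℚ.∣ p ℚ.- r ∣ ℚ.≤ ℚ.∣ p ℚ.- q ∣ ℚ.+ ℚ.∣ q ℚ.- r ∣
  dist-trans p q r = ≤-resp-≡ˡ
    (cong ℚ.∣_∣ (ℚS.solve 3 (λ p q r → (p ℚS.:- q) ℚS.:+ (q ℚS.:- r) ℚS.:= p ℚS.:- r) refl p q r))
    (ℚ.∣p+q∣≤∣p∣+∣q∣ (p ℚ.- q) (q ℚ.- r))

  add-sub : ∀ p q → q ℚ.+ (p ℚ.- q) ≡ p
  add-sub = ℚS.solve 2 (λ p q → q ℚS.:+ (p ℚS.:- q) ℚS.:= p) refl

  p≤q+dist : ∀ p q → p ℚ.≤ q ℚ.+ ℚ.∣ p ℚ.- q ∣
  p≤q+dist p q = ≤-resp-≡ˡ (add-sub p q) (ℚ.+-monoʳ-≤ q (p≤∣p∣ (p ℚ.- q)))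

  sub-≤ : ∀ {p q s} → p ℚ.≤ q ℚ.+ s → p ℚ.- q ℚ.≤ s
  sub-≤ {p} {q} {s} p≤ = subst (p ℚ.- q ℚ.≤_)
    (ℚS.solve 2 (λ q s → (q ℚS.:+ s) ℚS.:- q ℚS.:= s) refl q s)
    (ℚ.+-monoˡ-≤ (ℚ.- q) p≤)

  dist-≤ : ∀ {p q s} → p ℚ.≤ q ℚ.+ s → q ℚ.≤ p ℚ.+ s → ℚ.∣ p ℚ.- q ∣ ℚ.≤ s
  dist-≤ {p} {q} p≤ q≤ =
    ∣∣-lub (sub-≤ p≤) (≤-resp-≡ˡ (sym (neg-sub p q)) (sub-≤ q≤))

  -‿nonexp : ∀ p q → ℚ.∣ (ℚ.- p) ℚ.- (ℚ.- q) ∣ ℚ.≤ ℚ.∣ p ℚ.- q ∣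
  -‿nonexp p q = ℚ.≤-reflexive (trans
    (cong ℚ.∣_∣ (ℚS.solve 2 (λ p q → (ℚS.:- p) ℚS.:- (ℚS.:- q) ℚS.:= q ℚS.:- p) refl p q))
    (dist-sym q p))

  ∣∣-nonexp : ∀ p q → ℚ.∣ ℚ.∣ p ∣ ℚ.- ℚ.∣ q ∣ ∣ ℚ.≤ ℚ.∣ p ℚ.- q ∣
  ∣∣-nonexp p q = dist-≤ (half p q)
    (≤-resp-≡ʳ (cong (ℚ.∣ p ∣ ℚ.+_) (dist-sym q p)) (half q p))
    where
    half : ∀ p q → ℚ.∣ p ∣ ℚ.≤ ℚ.∣ q ∣ ℚ.+ ℚ.∣ p ℚ.- q ∣
    half p q = ≤-resp-≡ˡ (cong ℚ.∣_∣ (add-sub p q)) (ℚ.∣p+q∣≤∣p∣+∣q∣ q (p ℚ.- q))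

  +-nonexp : ∀ p q r s → ℚ.∣ (p ℚ.+ q) ℚ.- (r ℚ.+ s) ∣ ℚ.≤ ℚ.∣ p ℚ.- r ∣ ℚ.+ ℚ.∣ q ℚ.- s ∣
  +-nonexp p q r s = ≤-resp-≡ˡ
    (cong ℚ.∣_∣ (ℚS.solve 4 (λ p q r s → (p ℚS.:- r) ℚS.:+ (q ℚS.:- s)
                       ℚS.:= (p ℚS.:+ q) ℚS.:- (r ℚS.:+ s)) refl p q r s))
    (ℚ.∣p+q∣≤∣p∣+∣q∣ (p ℚ.- r) (q ℚ.- s))

  ⊔-nonexp : ∀ p q r s → ℚ.∣ (p ℚ.⊔ q) ℚ.- (r ℚ.⊔ s) ∣ ℚ.≤ ℚ.∣ p ℚ.- r ∣ ℚ.+ ℚ.∣ q ℚ.- s ∣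
  ⊔-nonexp p q r s = dist-≤ (half p q r s)
    (≤-resp-≡ʳ (cong ((p ℚ.⊔ q) ℚ.+_) (cong₂ ℚ._+_ (dist-sym r p) (dist-sym s q))) (half r s p q))
    where
    half : ∀ p q r s → p ℚ.⊔ q ℚ.≤ (r ℚ.⊔ s) ℚ.+ (ℚ.∣ p ℚ.- r ∣ ℚ.+ ℚ.∣ q ℚ.- s ∣)
    half p q r s = ℚ.⊔-lub
      (ℚ.≤-trans (p≤q+dist p r) (ℚ.+-mono-≤ (ℚ.p≤p⊔q r s)
        (≤-resp-≡ˡ (ℚ.+-identityʳ ℚ.∣ p ℚ.- r ∣)
          (ℚ.+-monoʳ-≤ ℚ.∣ p ℚ.- r ∣ (ℚ.0≤∣p∣ (q ℚ.- s))))))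
      (ℚ.≤-trans (p≤q+dist q s) (ℚ.+-mono-≤ (ℚ.p≤q⊔p r s)
        (≤-resp-≡ˡ (ℚ.+-identityˡ ℚ.∣ q ℚ.- s ∣)
          (ℚ.+-monoˡ-≤ ℚ.∣ q ℚ.- s ∣ (ℚ.0≤∣p∣ (p ℚ.- r))))))

-- A modulus of continuity for multiplication on the ball of radius b.
*-modulus : (b ε : ℚ) → 0ℚ ℚ.< b → ℚ
*-modulus b ε b>0 = (½ ℚ.* ε) ℚ.* (ℚ.1/ b) {{ℚ.>-nonZero b>0}}

opaque
  *-modulus>0 : ∀ {b ε} (b>0 : 0ℚ ℚ.< b) → 0ℚ ℚ.< ε → 0ℚ ℚ.< *-modulus b ε b>0
  *-modulus>0 {b} {ε} b>0 ε>0 = pos* {½ ℚ.* ε} (pos½ ε>0)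
    (ℚ.positive⁻¹ _ {{ℚ.1/pos⇒pos b {{ℚ.positive b>0}}}})

  *-close : ∀ {b ε} (b>0 : 0ℚ ℚ.< b) p q r s → ℚ.∣ p ∣ ℚ.≤ b → ℚ.∣ s ∣ ℚ.≤ b →
            ℚ.∣ p ℚ.- r ∣ ℚ.< *-modulus b ε b>0 → ℚ.∣ q ℚ.- s ∣ ℚ.< *-modulus b ε b>0 →
            ℚ.∣ p ℚ.* q ℚ.- r ℚ.* s ∣ ℚ.< ε
  *-close {b} {ε} b>0 p q r s p≤b s≤b pr qs = begin-strict
    ℚ.∣ p ℚ.* q ℚ.- r ℚ.* s ∣
      ≡⟨ cong ℚ.∣_∣ (ℚS.solve 4 (λ p q r s → p ℚS.:* q ℚS.:- r ℚS.:* s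
           ℚS.:= p ℚS.:* (q ℚS.:- s) ℚS.:+ s ℚS.:* (p ℚS.:- r)) refl p q r s) ⟩
    ℚ.∣ p ℚ.* (q ℚ.- s) ℚ.+ s ℚ.* (p ℚ.- r) ∣
      ≤⟨ ℚ.∣p+q∣≤∣p∣+∣q∣ (p ℚ.* (q ℚ.- s)) (s ℚ.* (p ℚ.- r)) ⟩
    ℚ.∣ p ℚ.* (q ℚ.- s) ∣ ℚ.+ ℚ.∣ s ℚ.* (p ℚ.- r) ∣
      <⟨ ℚ.+-mono-< (bound p (q ℚ.- s) p≤b qs) (bound s (p ℚ.- r) s≤b pr) ⟩
    b ℚ.* δ ℚ.+ b ℚ.* δ
      ≡⟨ cong₂ ℚ._+_ bδ bδ ⟩
    ½ ℚ.* ε ℚ.+ ½ ℚ.* ε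
      ≡⟨ halves ε ⟩
    ε ∎
    where
    open ℚ.≤-Reasoning
    instance
      b≢0 : ℚ.NonZero b
      b≢0 = ℚ.>-nonZero b>0
    δ : ℚ
    δ = *-modulus b ε b>0
    bδ : b ℚ.* δ ≡ ½ ℚ.* ε
    bδ = trans (ℚS.solve 3 (λ b e i → b ℚS.:* (e ℚS.:* i) ℚS.:= e ℚS.:* (b ℚS.:* i)) refl
                 b (½ ℚ.* ε) (ℚ.1/ b))
        (trans (cong ((½ ℚ.* ε) ℚ.*_) (ℚ.*-inverseʳ b)) (ℚ.*-identityʳ (½ ℚ.* ε)))
    bound : ∀ u v → ℚ.∣ u ∣ ℚ.≤ b → ℚ.∣ v ∣ ℚ.< δ → ℚ.∣ u ℚ.* v ∣ ℚ.< b ℚ.* δ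
    bound u v u≤b v<δ = <-resp-≡ˡ (sym (ℚ.∣p*q∣≡∣p∣*∣q∣ u v)) (ℚ.≤-<-trans
      (ℚ.*-monoʳ-≤-nonNeg ℚ.∣ v ∣ {{ℚ.∣-∣-nonNeg v}} u≤b)
      (ℚ.*-monoʳ-<-pos b {{ℚ.positive b>0}} v<δ))

inv₀ : ℚ → ℚ
inv₀ p with p ℚ.≟ 0ℚ
... | yes _  = 0ℚ
... | no p≢0 = (ℚ.1/ p) {{ℚ.≢-nonZero p≢0}}

opaque
  *-inv₀ : ∀ {δ} p → 0ℚ ℚ.< δ → δ ℚ.≤ ℚ.∣ p ∣ → p ℚ.* inv₀ p ≡ 1ℚ
  *-inv₀ p δ>0 δ≤p with p ℚ.≟ 0ℚ
  ... | yes refl = contradiction refl (ℚ.<⇒≢ (ℚ.<-≤-trans δ>0 δ≤p))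
  ... | no p≢0   = ℚ.*-inverseʳ p {{ℚ.≢-nonZero p≢0}}

  inv₀-close : ∀ {δ ε} p q → 0ℚ ℚ.< δ → δ ℚ.≤ ℚ.∣ p ∣ → δ ℚ.≤ ℚ.∣ q ∣ →
               ℚ.∣ p ℚ.- q ∣ ℚ.< (δ ℚ.* δ) ℚ.* ε → ℚ.∣ inv₀ p ℚ.- inv₀ q ∣ ℚ.< ε
  inv₀-close {δ} {ε} p q δ>0 δ≤p δ≤q pq =
    ℚ.*-cancelˡ-<-nonNeg (δ ℚ.* δ)
      {{ℚ.pos⇒nonNeg (δ ℚ.* δ) {{ℚ.positive (pos* δ>0 δ>0)}}}} (begin-strict
    (δ ℚ.* δ) ℚ.* d
      ≤⟨ ℚ.*-monoʳ-≤-nonNeg d {{ℚ.∣-∣-nonNeg (inv₀ p ℚ.- inv₀ q)}} δδ≤ ⟩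
    (ℚ.∣ p ∣ ℚ.* ℚ.∣ q ∣) ℚ.* d
      ≡⟨ cong (ℚ._* d) (ℚ.∣p*q∣≡∣p∣*∣q∣ p q) ⟨
    ℚ.∣ p ℚ.* q ∣ ℚ.* d
      ≡⟨ ℚ.∣p*q∣≡∣p∣*∣q∣ (p ℚ.* q) (inv₀ p ℚ.- inv₀ q) ⟨
    ℚ.∣ (p ℚ.* q) ℚ.* (inv₀ p ℚ.- inv₀ q) ∣
      ≡⟨ cong ℚ.∣_∣ (ℚS.solve 4 (λ p q i j → (p ℚS.:* q) ℚS.:* (i ℚS.:- j)
           ℚS.:= q ℚS.:* (p ℚS.:* i) ℚS.:- p ℚS.:* (q ℚS.:* j)) refl p q (inv₀ p) (inv₀ q)) ⟩
    ℚ.∣ q ℚ.* (p ℚ.* inv₀ p) ℚ.- p ℚ.* (q ℚ.* inv₀ q) ∣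
      ≡⟨ cong ℚ.∣_∣ (cong₂ ℚ._-_
           (trans (cong (q ℚ.*_) (*-inv₀ p δ>0 δ≤p)) (ℚ.*-identityʳ q))
           (trans (cong (p ℚ.*_) (*-inv₀ q δ>0 δ≤q)) (ℚ.*-identityʳ p))) ⟩
    ℚ.∣ q ℚ.- p ∣
      ≡⟨ dist-sym q p ⟩
    ℚ.∣ p ℚ.- q ∣
      <⟨ pq ⟩
    (δ ℚ.* δ) ℚ.* ε ∎)
    where
    open ℚ.≤-Reasoning
    d : ℚ
    d = ℚ.∣ inv₀ p ℚ.- inv₀ q ∣
    δδ≤ : δ ℚ.* δ ℚ.≤ ℚ.∣ p ∣ ℚ.* ℚ.∣ q ∣
    δδ≤ = ℚ.≤-trans
      (ℚ.*-monoˡ-≤-nonNeg δ {{ℚ.pos⇒nonNeg δ {{ℚ.positive δ>0}}}} δ≤q)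
      (ℚ.*-monoʳ-≤-nonNeg ℚ.∣ q ∣ {{ℚ.∣-∣-nonNeg q}} δ≤p)

  /-mono-≤ : ∀ a b c d → a ℕ.* suc d ℕ.≤ c ℕ.* suc b → + a ℚ./ suc b ℚ.≤ + c ℚ./ suc d
  /-mono-≤ a b c d ad≤cb = ℚ.toℚᵘ-cancel-≤
    (ℚᵘ.≤-respˡ-≃ (ℚᵘ.≃-sym (ℚ.toℚᵘ-fromℚᵘ (ℚᵘ.mkℚᵘ (+ a) b)))
    (ℚᵘ.≤-respʳ-≃ (ℚᵘ.≃-sym (ℚ.toℚᵘ-fromℚᵘ (ℚᵘ.mkℚᵘ (+ c) d)))
    (ℚᵘ.*≤* (subst₂ ℤ._≤_ (ℤ.pos-* a (suc d)) (ℤ.pos-* c (suc b)) (ℤ.+≤+ ad≤cb)))))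

  /-mono-< : ∀ a b c d → a ℕ.* suc d ℕ.< c ℕ.* suc b → + a ℚ./ suc b ℚ.< + c ℚ./ suc d
  /-mono-< a b c d ad<cb = ℚ.toℚᵘ-cancel-<
    (ℚᵘ.<-respˡ-≃ (ℚᵘ.≃-sym (ℚ.toℚᵘ-fromℚᵘ (ℚᵘ.mkℚᵘ (+ a) b)))
    (ℚᵘ.<-respʳ-≃ (ℚᵘ.≃-sym (ℚ.toℚᵘ-fromℚᵘ (ℚᵘ.mkℚᵘ (+ c) d)))
    (ℚᵘ.*<* (subst₂ ℤ._<_ (ℤ.pos-* a (suc d)) (ℤ.pos-* c (suc b)) (ℤ.+<+ ad<cb)))))

  add-over : ∀ p q r → (p ℤ.+ q) ℤ.* (r ℤ.* r) ≡ (q ℤ.* r ℤ.+ p ℤ.* r) ℤ.* r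
  add-over = solve 3 (λ p q r → (p :+ q) :* (r :* r) := (q :* r :+ p :* r) :* r) refl
    where open ℤSolver.+-*-Solver

  /ᵘ-suc : ∀ a b → ℚᵘ.mkℚᵘ (+ suc a) b ℚᵘ.≃ ℚᵘ.mkℚᵘ (+ a) b ℚᵘ.+ ℚᵘ.mkℚᵘ 1ℤ b
  /ᵘ-suc a b = ℚᵘ.*≡* (trans (cong (+ suc a ℤ.*_) (ℤ.pos-* (suc b) (suc b))) (add-over 1ℤ (+ a) (+ suc b)))

  /-suc : ∀ a b → + suc a ℚ./ suc b ≡ + a ℚ./ suc b ℚ.+ 1ℤ ℚ./ suc b
  /-suc a b = ℚ.toℚᵘ-injective
    (ℚᵘ.≃-trans (ℚ.toℚᵘ-fromℚᵘ (ℚᵘ.mkℚᵘ (+ suc a) b))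
    (ℚᵘ.≃-trans (/ᵘ-suc a b)
    (ℚᵘ.≃-trans (ℚᵘ.+-cong (ℚᵘ.≃-sym (ℚ.toℚᵘ-fromℚᵘ (ℚᵘ.mkℚᵘ (+ a) b)))
                           (ℚᵘ.≃-sym (ℚ.toℚᵘ-fromℚᵘ (ℚᵘ.mkℚᵘ 1ℤ b))))
      (ℚᵘ.≃-sym (ℚ.toℚᵘ-homo-+ (+ a ℚ./ suc b) (1ℤ ℚ./ suc b))))))

  archimedean : ∀ ε → 0ℚ ℚ.< ε → ∃ λ N → ∀ n → N ℕ.≤ n → 1ℤ ℚ./ suc n ℚ.< ε
  archimedean ε@(mkℚ (+ suc p) q _) _ = suc q , λ n q<n →
    subst (1ℤ ℚ./ suc n ℚ.<_) (ℚ.↥p/↧p≡p ε)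
      (/-mono-< 1 n (suc p) q (ℕ.≤-<-trans (ℕ.≤-reflexive (ℕ.*-identityˡ (suc q)))
        (ℕ.<-≤-trans (ℕ.s≤s q<n) (ℕ.m≤m+n (suc n) (p ℕ.* suc n)))))
  archimedean (mkℚ (+ zero) _ _) (ℚ.*<* (ℤ.+<+ ()))
  archimedean (mkℚ ℤ.-[1+ _ ] _ _) (ℚ.*<* ())

Eventually : (ℕ → Set) → Set
Eventually P = ∃ λ N → ∀ n → N ℕ.≤ n → P n

eventually₂ : {P Q R : ℕ → Set} → (∀ n → P n → Q n → R n) →
              Eventually P → Eventually Q → Eventually R
eventually₂ f (M , p) (N , q) = M ℕ.⊔ N , λ n M⊔N≤n →
  f n (p n (ℕ.m⊔n≤o⇒m≤o M N M⊔N≤n)) (q n (ℕ.m⊔n≤o⇒n≤o M N M⊔N≤n))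

IsCauchy : (ℕ → ℚ) → Set
IsCauchy s = ∀ ε → 0ℚ ℚ.< ε →
  ∃ λ N → ∀ m n → N ℕ.≤ m → N ℕ.≤ n → ℚ.∣ s m ℚ.- s n ∣ ℚ.< ε

-- No rate of convergence is prescribed, so all operations act termwise.
record ℝ : Set where
  constructor mkℝ
  field
    seq    : ℕ → ℚ
    cauchy : IsCauchy seq

open ℝ public

infix 4 _≈_ _≤_ _<_

record _≈_ (x y : ℝ) : Set where
  constructor mk≈
  field
    close : ∀ ε → 0ℚ ℚ.< ε → Eventually λ n → ℚ.∣ seq x n ℚ.- seq y n ∣ ℚ.< ε

open _≈_ public

record _≤_ (x y : ℝ) : Set where
  constructor mk≤
  field
    below : ∀ ε → 0ℚ ℚ.< ε → Eventually λ n → seq x n ℚ.≤ seq y n ℚ.+ ε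

open _≤_ public

record _<_ (x y : ℝ) : Set where
  constructor mk<
  field
    gap       : ℚ
    gap>0     : 0ℚ ℚ.< gap
    separated : Eventually λ n → seq x n ℚ.+ gap ℚ.≤ seq y n

open _<_ public

opaque
  ι-cauchy : ∀ p → IsCauchy (λ _ → p)
  ι-cauchy p ε ε>0 = 0 , λ _ _ _ _ → <-resp-≡ˡ (sym (dist-refl p)) ε>0

ι : ℚ → ℝ
ι p = mkℝ (λ _ → p) (ι-cauchy p)

0ℝ 1ℝ : ℝ
0ℝ = ι 0ℚ
1ℝ = ι 1ℚ

NonExpansive₁ : (ℚ → ℚ) → Set
NonExpansive₁ f = ∀ p q → ℚ.∣ f p ℚ.- f q ∣ ℚ.≤ ℚ.∣ p ℚ.- q ∣

NonExpansive₂ : (ℚ → ℚ → ℚ) → Set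
NonExpansive₂ f = ∀ p q r s → ℚ.∣ f p q ℚ.- f r s ∣ ℚ.≤ ℚ.∣ p ℚ.- r ∣ ℚ.+ ℚ.∣ q ℚ.- s ∣

opaque
  map₁-cauchy : ∀ f → NonExpansive₁ f → (x : ℝ) → IsCauchy (f ∘ seq x)
  map₁-cauchy f f-nonexp x ε ε>0 =
    let N , x-close = cauchy x ε ε>0 in
    N , λ m n N≤m N≤n → ℚ.≤-<-trans (f-nonexp (seq x m) (seq x n)) (x-close m n N≤m N≤n)

  map₂-cauchy : ∀ f → NonExpansive₂ f → (x y : ℝ) → IsCauchy (λ n → f (seq x n) (seq y n))
  map₂-cauchy f f-nonexp x y ε ε>0 =
    let M , x-close = cauchy x (½ ℚ.* ε) (pos½ ε>0)
        N , y-close = cauchy y (½ ℚ.* ε) (pos½ ε>0)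
    in M ℕ.⊔ N , λ m n ≤m ≤n → ℚ.≤-<-trans
      (f-nonexp (seq x m) (seq y m) (seq x n) (seq y n))
      (halves-< (x-close m n (ℕ.m⊔n≤o⇒m≤o M N ≤m) (ℕ.m⊔n≤o⇒m≤o M N ≤n))
                (y-close m n (ℕ.m⊔n≤o⇒n≤o M N ≤m) (ℕ.m⊔n≤o⇒n≤o M N ≤n)))

bounded : (x : ℝ) → ∃ λ b → 0ℚ ℚ.< b × Eventually λ n → ℚ.∣ seq x n ∣ ℚ.≤ b
bounded x =
  let N , x-close = cauchy x 1ℚ (ℚ.positive⁻¹ 1ℚ)
      b = ℚ.∣ seq x N ∣
  in b ℚ.+ 1ℚ ,
     ℚ.positive⁻¹ (b ℚ.+ 1ℚ) {{ℚ.nonNeg+pos⇒pos b {{ℚ.∣-∣-nonNeg (seq x N)}} 1ℚ}} ,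
     N , λ n N≤n → ℚ.≤-trans
       (≤-resp-≡ˡ (cong ℚ.∣_∣ (add-sub (seq x n) (seq x N)))
         (ℚ.∣p+q∣≤∣p∣+∣q∣ (seq x N) (seq x n ℚ.- seq x N)))
       (ℚ.+-monoʳ-≤ b (ℚ.<⇒≤ (x-close n N N≤n ℕ.≤-refl)))

bounded₂ : (x y : ℝ) → ∃ λ b → 0ℚ ℚ.< b ×
           Eventually λ n → ℚ.∣ seq x n ∣ ℚ.≤ b × ℚ.∣ seq y n ∣ ℚ.≤ b
bounded₂ x y =
  let b , b>0 , x≤b = bounded x
      c , _   , y≤c = bounded y
  in b ℚ.⊔ c , ℚ.<-≤-trans b>0 (ℚ.p≤p⊔q b c) ,
     eventually₂ (λ _ x≤ y≤ → ℚ.≤-trans x≤ (ℚ.p≤p⊔q b c) , ℚ.≤-trans y≤ (ℚ.p≤q⊔p b c)) x≤b y≤c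

opaque
  *-cauchy : (x y : ℝ) → IsCauchy (λ n → seq x n ℚ.* seq y n)
  *-cauchy x y ε ε>0 =
    let b , b>0 , K , ≤b = bounded₂ x y
        δ>0 = *-modulus>0 b>0 ε>0
        M , x-close = cauchy x (*-modulus b ε b>0) δ>0
        N , y-close = cauchy y (*-modulus b ε b>0) δ>0
        L = K ℕ.⊔ (M ℕ.⊔ N)
        K≤ = λ {m} (L≤m : L ℕ.≤ m) → ℕ.m⊔n≤o⇒m≤o K (M ℕ.⊔ N) L≤m
        M≤ = λ {m} (L≤m : L ℕ.≤ m) → ℕ.m⊔n≤o⇒m≤o M N (ℕ.m⊔n≤o⇒n≤o K (M ℕ.⊔ N) L≤m)
        N≤ = λ {m} (L≤m : L ℕ.≤ m) → ℕ.m⊔n≤o⇒n≤o M N (ℕ.m⊔n≤o⇒n≤o K (M ℕ.⊔ N) L≤m)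
    in L , λ m n ≤m ≤n → *-close b>0 (seq x m) (seq y m) (seq x n) (seq y n)
      (proj₁ (≤b m (K≤ ≤m))) (proj₂ (≤b n (K≤ ≤n)))
      (x-close m n (M≤ ≤m) (M≤ ≤n)) (y-close m n (N≤ ≤m) (N≤ ≤n))

infixl 6 _+_ _⊔_
infixl 7 _*_
infix  8 -_

_+_ : ℝ → ℝ → ℝ
x + y = mkℝ (λ n → seq x n ℚ.+ seq y n) (map₂-cauchy ℚ._+_ +-nonexp x y)

-_ : ℝ → ℝ
- x = mkℝ (λ n → ℚ.- seq x n) (map₁-cauchy (ℚ.-_) -‿nonexp x)

∣_∣ : ℝ → ℝ
∣ x ∣ = mkℝ (λ n → ℚ.∣ seq x n ∣) (map₁-cauchy ℚ.∣_∣ ∣∣-nonexp x)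

_⊔_ : ℝ → ℝ → ℝ
x ⊔ y = mkℝ (λ n → seq x n ℚ.⊔ seq y n) (map₂-cauchy ℚ._⊔_ ⊔-nonexp x y)

_*_ : ℝ → ℝ → ℝ
x * y = mkℝ (λ n → seq x n ℚ.* seq y n) (*-cauchy x y)

record _#0 (x : ℝ) : Set where
  constructor mk#0
  field
    gap       : ℚ
    gap>0     : 0ℚ ℚ.< gap
    separated : Eventually λ n → gap ℚ.≤ ℚ.∣ seq x n ∣

opaque
  recip-cauchy : (x : ℝ) → x #0 → IsCauchy (inv₀ ∘ seq x)
  recip-cauchy x (mk#0 δ δ>0 (M , δ≤)) ε ε>0 =
    let N , x-close = cauchy x ((δ ℚ.* δ) ℚ.* ε) (pos* (pos* δ>0 δ>0) ε>0) in
    M ℕ.⊔ N , λ m n ≤m ≤n → inv₀-close (seq x m) (seq x n) δ>0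
      (δ≤ m (ℕ.m⊔n≤o⇒m≤o M N ≤m)) (δ≤ n (ℕ.m⊔n≤o⇒m≤o M N ≤n))
      (x-close m n (ℕ.m⊔n≤o⇒n≤o M N ≤m) (ℕ.m⊔n≤o⇒n≤o M N ≤n))

-- Finitely many terms of x may vanish; inv₀ sends those to 0.
recip : (x : ℝ) → x #0 → ℝ
recip x x#0 = mkℝ (inv₀ ∘ seq x) (recip-cauchy x x#0)

≗⇒≈ : ∀ {x y} → seq x ≗ seq y → x ≈ y
≗⇒≈ {x} {y} x≗y = mk≈ λ ε ε>0 → 0 , λ n _ → <-resp-≡ˡ
  (sym (trans (cong (λ p → ℚ.∣ p ℚ.- seq y n ∣) (x≗y n)) (dist-refl (seq y n)))) ε>0

≈-refl : ∀ {x} → x ≈ x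
≈-refl = ≗⇒≈ λ _ → refl

≈-sym : ∀ {x y} → x ≈ y → y ≈ x
≈-sym {x} {y} x≈y = mk≈ λ ε ε>0 → let N , c = close x≈y ε ε>0 in
  N , λ n N≤n → <-resp-≡ˡ (dist-sym (seq x n) (seq y n)) (c n N≤n)

≈-trans : ∀ {x y z} → x ≈ y → y ≈ z → x ≈ z
≈-trans {x} {y} {z} x≈y y≈z = mk≈ λ ε ε>0 → eventually₂
  (λ n xy yz → ℚ.≤-<-trans (dist-trans (seq x n) (seq y n) (seq z n)) (halves-< xy yz))
  (close x≈y (½ ℚ.* ε) (pos½ ε>0)) (close y≈z (½ ℚ.* ε) (pos½ ε>0))

+-cong : ∀ {x y u v} → x ≈ y → u ≈ v → x + u ≈ y + v
+-cong {x} {y} {u} {v} x≈y u≈v = mk≈ λ ε ε>0 → eventually₂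
  (λ n xy uv → ℚ.≤-<-trans (+-nonexp (seq x n) (seq u n) (seq y n) (seq v n)) (halves-< xy uv))
  (close x≈y (½ ℚ.* ε) (pos½ ε>0)) (close u≈v (½ ℚ.* ε) (pos½ ε>0))

-‿cong : ∀ {x y} → x ≈ y → - x ≈ - y
-‿cong {x} {y} x≈y = mk≈ λ ε ε>0 → let N , c = close x≈y ε ε>0 in
  N , λ n N≤n → ℚ.≤-<-trans (-‿nonexp (seq x n) (seq y n)) (c n N≤n)

*-cong : ∀ {x y u v} → x ≈ y → u ≈ v → x * u ≈ y * v
*-cong {x} {y} {u} {v} x≈y u≈v = mk≈ λ ε ε>0 →
  let b , b>0 , ≤b = bounded₂ x v
      δ>0 = *-modulus>0 b>0 ε>0
  in eventually₂
    (λ n (x≤b , v≤b) (xy , uv) →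
      *-close b>0 (seq x n) (seq u n) (seq y n) (seq v n) x≤b v≤b xy uv)
    ≤b
    (eventually₂ (λ _ → _,_) (close x≈y (*-modulus b ε b>0) δ>0) (close u≈v (*-modulus b ε b>0) δ>0))

opaque
  ℝ-isCommutativeRing : IsCommutativeRing _≈_ _+_ _*_ -_ 0ℝ 1ℝ
  ℝ-isCommutativeRing = record
    { isRing = record
      { +-isAbelianGroup = record
        { isGroup = record
          { isMonoid = record
            { isSemigroup = record
              { isMagma = record
                { isEquivalence = record { refl = ≈-refl ; sym = ≈-sym ; trans = ≈-trans }
                ; ∙-cong = +-cong
                }
              ; assoc = λ x y z → ≗⇒≈ λ n → ℚ.+-assoc (seq x n) (seq y n) (seq z n)
              }
            ; identity = (λ x → ≗⇒≈ λ n → ℚ.+-identityˡ (seq x n))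
                       , (λ x → ≗⇒≈ λ n → ℚ.+-identityʳ (seq x n))
            }
          ; inverse = (λ x → ≗⇒≈ λ n → ℚ.+-inverseˡ (seq x n))
                    , (λ x → ≗⇒≈ λ n → ℚ.+-inverseʳ (seq x n))
          ; ⁻¹-cong = -‿cong
          }
        ; comm = λ x y → ≗⇒≈ λ n → ℚ.+-comm (seq x n) (seq y n)
        }
      ; *-cong = *-cong
      ; *-assoc = λ x y z → ≗⇒≈ λ n → ℚ.*-assoc (seq x n) (seq y n) (seq z n)
      ; *-identity = (λ x → ≗⇒≈ λ n → ℚ.*-identityˡ (seq x n))
                   , (λ x → ≗⇒≈ λ n → ℚ.*-identityʳ (seq x n))
      ; distrib = (λ x y z → ≗⇒≈ λ n → ℚ.*-distribˡ-+ (seq x n) (seq y n) (seq z n))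
                , (λ x y z → ≗⇒≈ λ n → ℚ.*-distribʳ-+ (seq x n) (seq y n) (seq z n))
      }
    ; *-comm = λ x y → ≗⇒≈ λ n → ℚ.*-comm (seq x n) (seq y n)
    }

ℝ-commutativeRing : CommutativeRing 0ℓ 0ℓ
ℝ-commutativeRing = record { isCommutativeRing = ℝ-isCommutativeRing }

recip-inverse : ∀ x (x#0 : x #0) → x * recip x x#0 ≈ 1ℝ
recip-inverse x (mk#0 δ δ>0 (M , δ≤)) = mk≈ λ ε ε>0 → M , λ n M≤n → <-resp-≡ˡ
  (sym (trans (cong (λ p → ℚ.∣ p ℚ.- 1ℚ ∣) (*-inv₀ (seq x n) δ>0 (δ≤ n M≤n))) (dist-refl 1ℚ))) ε>0

⌊√_⌋ : ℕ → ℕ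
⌊√ zero ⌋ = 0
⌊√ suc m ⌋ with suc ⌊√ m ⌋ ℕ.* suc ⌊√ m ⌋ ℕ.≤? suc m
... | yes _ = suc ⌊√ m ⌋
... | no  _ = ⌊√ m ⌋

⌊√⌋-lower : ∀ m → ⌊√ m ⌋ ℕ.* ⌊√ m ⌋ ℕ.≤ m
⌊√⌋-lower zero = ℕ.z≤n
⌊√⌋-lower (suc m) with suc ⌊√ m ⌋ ℕ.* suc ⌊√ m ⌋ ℕ.≤? suc m
... | yes ≤m = ≤m
... | no  _  = ℕ.m≤n⇒m≤1+n (⌊√⌋-lower m)

⌊√⌋-upper : ∀ m → m ℕ.< suc ⌊√ m ⌋ ℕ.* suc ⌊√ m ⌋
⌊√⌋-upper zero = ℕ.s≤s ℕ.z≤n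
⌊√⌋-upper (suc m) with suc ⌊√ m ⌋ ℕ.* suc ⌊√ m ⌋ ℕ.≤? suc m
... | yes _  = ℕ.≤-<-trans (⌊√⌋-upper m)
                 (ℕ.*-mono-< (ℕ.n<1+n (suc ⌊√ m ⌋)) (ℕ.n<1+n (suc ⌊√ m ⌋)))
... | no ≰m  = ℕ.≰⇒> ≰m

sq-cancel-≤ : ∀ {a b} → a ℕ.* a ℕ.≤ b ℕ.* b → a ℕ.≤ b
sq-cancel-≤ {a} {b} aa≤bb with a ℕ.≤? b
... | yes a≤b = a≤b
... | no  a≰b = contradiction aa≤bb (ℕ.<⇒≱ (ℕ.*-mono-< (ℕ.≰⇒> a≰b) (ℕ.≰⇒> a≰b)))

sq-cancel-< : ∀ {a b} → a ℕ.* a ℕ.< b ℕ.* b → a ℕ.< b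
sq-cancel-< {a} {b} aa<bb with a ℕ.<? b
... | yes a<b = a<b
... | no  a≮b = contradiction aa<bb (ℕ.≤⇒≯ (ℕ.*-mono-≤ (ℕ.≮⇒≥ a≮b) (ℕ.≮⇒≥ a≮b)))

sq-* : ∀ a b → (a ℕ.* b) ℕ.* (a ℕ.* b) ≡ (a ℕ.* a) ℕ.* (b ℕ.* b)
sq-* = +-*-Solver.solve 2 (λ a b → (a :* b) :* (a :* b) := (a :* a) :* (b :* b)) refl
  where open +-*-Solver using (_:*_; _:=_)

√numer : ℕ → ℕ → ℕ
√numer k j = ⌊√ k ℕ.* (suc j ℕ.* suc j) ⌋

-- The largest multiple of 1/(j+1) whose square is at most k.
√-approx : ℕ → ℕ → ℚ
√-approx k j = + √numer k j ℚ./ suc j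

√-approx-≤ : ∀ k i j → √-approx k i ℚ.≤ √-approx k j ℚ.+ 1ℤ ℚ./ suc j
√-approx-≤ k i j = subst (√-approx k i ℚ.≤_) (/-suc (√numer k j) j)
  (/-mono-≤ (√numer k i) i (suc (√numer k j)) j (sq-cancel-≤ (begin
    (a ℕ.* suc j) ℕ.* (a ℕ.* suc j)
      ≡⟨ sq-* a (suc j) ⟩
    (a ℕ.* a) ℕ.* (suc j ℕ.* suc j)
      ≤⟨ ℕ.*-monoˡ-≤ (suc j ℕ.* suc j) (⌊√⌋-lower (k ℕ.* (suc i ℕ.* suc i))) ⟩
    (k ℕ.* (suc i ℕ.* suc i)) ℕ.* (suc j ℕ.* suc j)
      ≡⟨ swap k (suc i ℕ.* suc i) (suc j ℕ.* suc j) ⟩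
    (k ℕ.* (suc j ℕ.* suc j)) ℕ.* (suc i ℕ.* suc i)
      ≤⟨ ℕ.*-monoˡ-≤ (suc i ℕ.* suc i) (ℕ.<⇒≤ (⌊√⌋-upper (k ℕ.* (suc j ℕ.* suc j)))) ⟩
    (c ℕ.* c) ℕ.* (suc i ℕ.* suc i)
      ≡⟨ sq-* c (suc i) ⟨
    (c ℕ.* suc i) ℕ.* (c ℕ.* suc i) ∎)))
  where
  open ℕ.≤-Reasoning
  a c : ℕ
  a = √numer k i
  c = suc (√numer k j)
  swap : ∀ x y z → (x ℕ.* y) ℕ.* z ≡ (x ℕ.* z) ℕ.* y
  swap = +-*-Solver.solve 3 (λ x y z → (x :* y) :* z := (x :* z) :* y) refl
    where open +-*-Solver using (_:*_; _:=_)

1≤√-approx : ∀ k j .{{_ : NonZero k}} → 1ℚ ℚ.≤ √-approx k j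
1≤√-approx k j = /-mono-≤ 1 0 (√numer k j) j (subst₂ ℕ._≤_
  (sym (ℕ.*-identityˡ (suc j))) (sym (ℕ.*-identityʳ (√numer k j)))
  (ℕ.s≤s⁻¹ (sq-cancel-< {suc j} (ℕ.≤-<-trans
    (ℕ.m≤n*m (suc j ℕ.* suc j) k) (⌊√⌋-upper (k ℕ.* (suc j ℕ.* suc j)))))))

opaque
  √-cauchy : ∀ k → IsCauchy (√-approx k)
  √-cauchy k ε ε>0 =
    let N , small = archimedean ε ε>0 in
    N , λ m n N≤m N≤n →
      let 1/m = 1ℤ ℚ./ suc m
          1/n = 1ℤ ℚ./ suc n
      in ℚ.≤-<-trans
        (dist-≤
          (ℚ.≤-trans (√-approx-≤ k m n) (ℚ.+-monoʳ-≤ (√-approx k n) (ℚ.p≤q⊔p 1/m 1/n)))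
          (ℚ.≤-trans (√-approx-≤ k n m) (ℚ.+-monoʳ-≤ (√-approx k m) (ℚ.p≤p⊔q 1/m 1/n))))
        (⊔-< (small m N≤m) (small n N≤n))
    where
    ⊔-< : ∀ {p q r} → p ℚ.< r → q ℚ.< r → p ℚ.⊔ q ℚ.< r
    ⊔-< {p} {q} p<r q<r with ℚ.⊔-sel p q
    ... | inj₁ eq = <-resp-≡ˡ (sym eq) p<r
    ... | inj₂ eq = <-resp-≡ˡ (sym eq) q<r

√_ : ℕ → ℝ
√ k = mkℝ (√-approx k) (√-cauchy k)

opaque
  √-#0 : ∀ k .{{_ : NonZero k}} → (√ k) #0
  √-#0 k = mk#0 1ℚ (ℚ.positive⁻¹ 1ℚ) (0 , λ j _ →
    ℚ.≤-trans (1≤√-approx k j) (p≤∣p∣ (√-approx k j)))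

infixl 7 _/√_

_/√_ : ℝ → (k : ℕ) .{{_ : NonZero k}} → ℝ
x /√ k = x * recip (√ k) (√-#0 k)

open CommutativeRing ℝ-commutativeRing using (+-commutativeMonoid)

sumℤ : ∀ {n} → Vector ℤ n → ℤ
sumℤ = Sum.sum ℤ.+-0-commutativeMonoid

sumℝ : ∀ {n} → Vector ℝ n → ℝ
sumℝ = Sum.sum +-commutativeMonoid

-- Only applied to vectors of absolute values, for which the start value
-- 0 is harmless.
maxℝ : ∀ {n} → Vector ℝ n → ℝ
maxℝ = foldr _⊔_ 0ℝ

SquareMatrix : Set → ℕ → Set
SquareMatrix A k = Fin k → Fin k → A

δ : ∀ {k} → SquareMatrix ℝ k
δ i j with i Fin.≟ j
... | yes _ = 1ℝ
... | no  _ = 0ℝ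

-- A ±1 entry is an exact integer, so the orthogonality of the rows of a
-- real Hadamard matrix is an identity in ℤ.
record IsHadamard {m : ℕ} (H : SquareMatrix ℤ m) : Set where
  field
    entries         : ∀ i j → H i j ≡ 1ℤ ⊎ H i j ≡ -1ℤ
    rows-orthogonal : ∀ i j → i ≢ j → sumℤ (λ l → H i l ℤ.* H j l) ≡ 0ℤ

record IsOrthogonal {k : ℕ} (O : SquareMatrix ℝ k) : Set where
  field
    rows-orthonormal    : ∀ i j → sumℝ (λ l → O i l * O j l) ≈ δ i j
    columns-orthonormal : ∀ i j → sumℝ (λ l → O l i * O l j) ≈ δ i j

-- The decay of the errors as k varies is a property of a family of
-- matrices and imposes nothing on a single one.
record IsEpsHadamard {k : ℕ} .{{_ : NonZero k}} (ε : ℝ) (O : SquareMatrix ℝ k) : Set where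
  field
    orthogonal   : IsOrthogonal O
    error        : SquareMatrix ℝ k
    entries      : ∀ i j → ∣ O i j ∣ ≈ (1ℝ + error i j) /√ k
    ε-is-maximum : ε ≈ maxℝ (λ i → maxℝ (λ j → ∣ error i j ∣))
    ε<1          : ε < 1ℝ

-- Only the values at 1, 2 and 3 matter.
ρ : ℕ → ℚ
ρ 1 = ½
ρ 2 = + 2 ℚ./ 1
ρ 3 = + 4 ℚ./ 1
ρ _ = 0ℚ

4n∸t-nonZero : ∀ n t .{{_ : NonZero n}} → t ℕ.≤ 3 → NonZero (4 ℕ.* n ℕ.∸ t)
4n∸t-nonZero n t t≤3 = ℕ.>-nonZero (ℕ.m<n⇒0<n∸m
  (ℕ.≤-<-trans t≤3 (ℕ.*-monoʳ-≤ 4 (ℕ.>-nonZero⁻¹ n))))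

{-# OPTIONS --safe #-}

-- Scale a Hadamard matrix of order N = 4n by r = 1/√N and repeatedly pass
-- from an orthogonal matrix U to the one of order one less obtained by
-- feeding an output of U back into an input: with pivot a, rest of its
-- column c and rest of its row b, the complementary block d becomes
-- d - κ c bᵀ with κ = ±1/(1+|a|), the sign being that of a.  If all entries
-- of U have modulus between (1-e)r and (1+e)r and |a| ≥ r, then the new
-- entries satisfy the same bounds with e + g(1+e)², where g = r/(1+r).
-- A pivot with |a| ≥ r exists because a row of U is a unit vector with at
-- most N entries.  Starting from e = 0, at most three steps give an
-- e < 1 of order 1/√n.
module Submission where

open import Defs
open import Algebra.Bundles using (CommutativeRing)
import Algebra.Properties.Semiring.Sum
import Algebra.Solver.Ring
open import Algebra.Solver.Ring.AlmostCommutativeRing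
  using (AlmostCommutativeRing; fromCommutativeRing; _-Raw-AlmostCommutative⟶_)
open import Data.Empty using (⊥; ⊥-elim)
open import Data.Fin.Base using (Fin; zero; suc; punchIn)
import Data.Fin.Properties as Fin
open import Data.Integer.Base as ℤ using (ℤ; +_; 1ℤ)
import Data.Integer.Properties as ℤ
open import Data.Maybe.Base using (Maybe; just; nothing)
open import Data.Nat.Base as ℕ using (ℕ; zero; suc; NonZero; s≤s)
import Data.Nat.Properties as ℕ
open import Data.Product.Base using (∃; _×_; _,_; proj₁; proj₂)
open import Data.Rational.Base as ℚ using (ℚ; 0ℚ; 1ℚ; ½)
import Data.Rational.Properties as ℚ
import Data.Rational.Unnormalised.Base as ℚᵘ
import Data.Rational.Unnormalised.Properties as ℚᵘ
open import Data.Sum.Base using (_⊎_; inj₁; inj₂; [_,_]′)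
open import Data.Vec.Functional using (Vector)
open import Function.Base using (case_of_; _∘_)
open import Level using (0ℓ)
open import Relation.Binary.Bundles using (Poset)
open import Relation.Binary.PropositionalEquality
  using (_≡_; refl; sym; trans; cong; cong₂; subst; subst₂)
import Relation.Binary.Reasoning.PartialOrder
open import Relation.Nullary using (yes; no; contradiction)
open import Relation.Nullary.Decidable using (from-yes)

-- Closing the loop keeps orthogonality because U preserves norms: if (y₀, y) = U (x₀, x) and x₀ =
-- ±y₀, then x₀² and y₀² cancel from x₀² + |x|² = y₀² + |y|². The two signs correspond to κ =
-- 1/(1+a) and κ = -1/(1-a); the one of smaller modulus keeps the correction small. The obstacle is
-- that the order on Cauchy reals is undecidable, so neither a largest entry nor the sign of a pivot
-- can simply be computed. Each such choice goes through cotransitivity, which needs a strict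
-- inequality to start from. For a row of length m < N this is 1 = N r² > m r²; for the sign it is
-- -r < r. At order N the first one degenerates to an equality, but there every entry is ±r, so the
-- first reduction is treated separately.

module R = CommutativeRing ℝ-commutativeRing

-- Cotransitivity of the strict order

p≤p+q : ∀ p {q} → 0ℚ ℚ.≤ q → p ℚ.≤ p ℚ.+ q
p≤p+q p q≥0 = ≤-resp-≡ˡ (ℚ.+-identityʳ p) (ℚ.+-monoʳ-≤ p q≥0)

-- The usable substitute for trichotomy. From index `K` on, the terms of `x` and of `z` move by less
-- than `θ`, an eighth of the gap, so a single rational comparison of `seq z K` with the middle
-- `seq x K + 4θ` of the gap settles all later terms.
<-cotrans : ∀ {x y} → x < y → ∀ z → x < z ⊎ z < y
<-cotrans {x} {y} (mk< η η>0 (L , sep)) z with cauchy x θ θ>0 | cauchy z θ θ>0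
  where
  θ : ℚ
  θ = ½ ℚ.* (½ ℚ.* (½ ℚ.* η))
  θ>0 : 0ℚ ℚ.< θ
  θ>0 = pos½ (pos½ (pos½ η>0))
... | M , x-close | N , z-close = case ℚ.≤-total (seq x K ℚ.+ 4θ) (seq z K) of λ where
    (inj₁ x≤z) → inj₁ (mk< θ θ>0 (K , λ n K≤n → let open ℚ.≤-Reasoning in begin
      seq x n ℚ.+ θ              ≤⟨ ℚ.+-monoˡ-≤ θ (x-near n K K≤n ℕ.≤-refl) ⟩
      seq x K ℚ.+ θ ℚ.+ θ        ≤⟨ p≤p+q _ θ≥0 ⟩
      seq x K ℚ.+ θ ℚ.+ θ ℚ.+ θ  ≡⟨ ℚS.solve 2 (λ p t → p :+ t :+ t :+ t
            := p :+ (t :+ t :+ (t :+ t)) :- t) refl (seq x K) θ ⟩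
      seq x K ℚ.+ 4θ ℚ.- θ       ≤⟨ ℚ.+-monoˡ-≤ (ℚ.- θ) x≤z ⟩
      seq z K ℚ.- θ              ≤⟨ ℚ.+-monoˡ-≤ (ℚ.- θ) (z-near K n ℕ.≤-refl K≤n) ⟩
      seq z n ℚ.+ θ ℚ.- θ        ≡⟨ ℚS.solve 2 (λ p t → p :+ t :- t := p) refl (seq z n) θ ⟩
      seq z n                    ∎))
    (inj₂ z≤x) → inj₂ (mk< θ θ>0 (K , λ n K≤n → let open ℚ.≤-Reasoning in begin
      seq z n ℚ.+ θ              ≤⟨ ℚ.+-monoˡ-≤ θ (z-near n K K≤n ℕ.≤-refl) ⟩
      seq z K ℚ.+ θ ℚ.+ θ        ≤⟨ ℚ.+-monoˡ-≤ θ (ℚ.+-monoˡ-≤ θ z≤x) ⟩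
      seq x K ℚ.+ 4θ ℚ.+ θ ℚ.+ θ ≤⟨ ℚ.+-monoˡ-≤ θ (ℚ.+-monoˡ-≤ θ (ℚ.+-monoˡ-≤ 4θ (x-near K n ℕ.≤-refl K≤n))) ⟩
      seq x n ℚ.+ θ ℚ.+ 4θ ℚ.+ θ ℚ.+ θ ≤⟨ p≤p+q _ θ≥0 ⟩
      seq x n ℚ.+ θ ℚ.+ 4θ ℚ.+ θ ℚ.+ θ ℚ.+ θ
        ≡⟨ ℚS.solve 2 (λ p e → let t = con ½ :* (con ½ :* (con ½ :* e)) in
             p :+ t :+ (t :+ t :+ (t :+ t)) :+ t :+ t :+ t := p :+ e) refl (seq x n) η ⟩
      seq x n ℚ.+ η              ≤⟨ sep n (ℕ.m⊔n≤o⇒m≤o L (M ℕ.⊔ N) K≤n) ⟩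
      seq y n                    ∎))
  where
  open ℚS using (_:+_; _:-_; _:*_; _:=_; con)
  K : ℕ
  K = L ℕ.⊔ (M ℕ.⊔ N)
  θ 4θ : ℚ
  θ = ½ ℚ.* (½ ℚ.* (½ ℚ.* η))
  4θ = θ ℚ.+ θ ℚ.+ (θ ℚ.+ θ)
  θ>0 : 0ℚ ℚ.< θ
  θ>0 = pos½ (pos½ (pos½ η>0))
  θ≥0 : 0ℚ ℚ.≤ θ
  θ≥0 = ℚ.<⇒≤ θ>0
  x-near : ∀ m n → K ℕ.≤ m → K ℕ.≤ n → seq x m ℚ.≤ seq x n ℚ.+ θ
  x-near m n K≤m K≤n = ℚ.≤-trans (p≤q+dist (seq x m) (seq x n))
    (ℚ.+-monoʳ-≤ (seq x n) (ℚ.<⇒≤ (x-close m n (M≤ K≤m) (M≤ K≤n))))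
    where
    M≤ : ∀ {n} → K ℕ.≤ n → M ℕ.≤ n
    M≤ K≤n = ℕ.m⊔n≤o⇒m≤o M N (ℕ.m⊔n≤o⇒n≤o L (M ℕ.⊔ N) K≤n)
  z-near : ∀ m n → K ℕ.≤ m → K ℕ.≤ n → seq z m ℚ.≤ seq z n ℚ.+ θ
  z-near m n K≤m K≤n = ℚ.≤-trans (p≤q+dist (seq z m) (seq z n))
    (ℚ.+-monoʳ-≤ (seq z n) (ℚ.<⇒≤ (z-close m n (N≤ K≤m) (N≤ K≤n))))
    where
    N≤ : ∀ {n} → K ℕ.≤ n → N ℕ.≤ n
    N≤ K≤n = ℕ.m⊔n≤o⇒n≤o M N (ℕ.m⊔n≤o⇒n≤o L (M ℕ.⊔ N) K≤n)

-- A ring solver for the reals with rational coefficients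

ℝ-almostCommutativeRing : AlmostCommutativeRing 0ℓ 0ℓ
ℝ-almostCommutativeRing = fromCommutativeRing ℝ-commutativeRing

ι-morphism : CommutativeRing.rawRing ℚ.+-*-commutativeRing -Raw-AlmostCommutative⟶ ℝ-almostCommutativeRing
ι-morphism = record
  { ⟦_⟧    = ι
  ; +-homo = λ _ _ → ≗⇒≈ λ _ → refl
  ; *-homo = λ _ _ → ≗⇒≈ λ _ → refl
  ; -‿homo = λ _ → ≗⇒≈ λ _ → refl
  ; 0-homo = ≈-refl
  ; 1-homo = ≈-refl
  }

ι-≟ : ∀ p q → Maybe (ι p ≈ ι q)
ι-≟ p q with p ℚ.≟ q
... | yes refl = just ≈-refl
... | no  _    = nothing

open Algebra.Solver.Ring (CommutativeRing.rawRing ℚ.+-*-commutativeRing)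
  ℝ-almostCommutativeRing ι-morphism ι-≟

-- Order, absolute value and inverses

≤-by-terms : ∀ {x y} → (∀ n → seq x n ℚ.≤ seq y n) → x ≤ y
≤-by-terms {x} {y} x≤y = mk≤ λ ε ε>0 → 0 , λ n _ →
  ℚ.≤-trans (x≤y n) (p≤p+q (seq y n) (ℚ.<⇒≤ ε>0))

≤-reflexive : ∀ {x y} → x ≈ y → x ≤ y
≤-reflexive {x} {y} x≈y = mk≤ λ ε ε>0 → let N , c = close x≈y ε ε>0 in
  N , λ n N≤n → ℚ.≤-trans (p≤q+dist (seq x n) (seq y n)) (ℚ.+-monoʳ-≤ (seq y n) (ℚ.<⇒≤ (c n N≤n)))

+-halves : ∀ q ε → (q ℚ.+ ½ ℚ.* ε) ℚ.+ ½ ℚ.* ε ≡ q ℚ.+ ε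
+-halves q ε = trans (ℚ.+-assoc q (½ ℚ.* ε) (½ ℚ.* ε)) (cong (q ℚ.+_) (halves ε))

≤-trans : ∀ {x y z} → x ≤ y → y ≤ z → x ≤ z
≤-trans {x} {y} {z} x≤y y≤z = mk≤ λ ε ε>0 → eventually₂
  (λ n xy yz → ≤-resp-≡ʳ (+-halves (seq z n) ε)
    (ℚ.≤-trans xy (ℚ.+-monoˡ-≤ (½ ℚ.* ε) yz)))
  (below x≤y (½ ℚ.* ε) (pos½ ε>0)) (below y≤z (½ ℚ.* ε) (pos½ ε>0))

½*-< : ∀ {ε} → 0ℚ ℚ.< ε → ½ ℚ.* ε ℚ.< ε
½*-< {ε} ε>0 = <-resp-≡ʳ (halves ε)
  (<-resp-≡ˡ (ℚ.+-identityʳ (½ ℚ.* ε)) (ℚ.+-monoʳ-< (½ ℚ.* ε) (pos½ ε>0)))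

≤-antisym : ∀ {x y} → x ≤ y → y ≤ x → x ≈ y
≤-antisym x≤y y≤x = mk≈ λ ε ε>0 → eventually₂
  (λ _ xy yx → ℚ.≤-<-trans (dist-≤ xy yx) (½*-< ε>0))
  (below x≤y (½ ℚ.* ε) (pos½ ε>0)) (below y≤x (½ ℚ.* ε) (pos½ ε>0))

≤-poset : Poset 0ℓ 0ℓ 0ℓ
≤-poset = record
  { isPartialOrder = record
    { isPreorder = record
      { isEquivalence = R.isEquivalence
      ; reflexive     = ≤-reflexive
      ; trans         = ≤-trans
      }
    ; antisym = ≤-antisym
    }
  }

open import Relation.Binary.Reasoning.PartialOrder ≤-poset

+-mono-≤ : ∀ {x y u v} → x ≤ y → u ≤ v → x + u ≤ y + v
+-mono-≤ {x} {y} {u} {v} x≤y u≤v = mk≤ λ ε ε>0 → eventually₂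
  (λ n xy uv → ≤-resp-≡ʳ
    (trans (ℚS.solve 3 (λ p q h → (p ℚS.:+ h) ℚS.:+ (q ℚS.:+ h) ℚS.:= (p ℚS.:+ q) ℚS.:+ (h ℚS.:+ h))
             refl (seq y n) (seq v n) (½ ℚ.* ε))
           (cong ((seq y n ℚ.+ seq v n) ℚ.+_) (halves ε)))
    (ℚ.+-mono-≤ xy uv))
  (below x≤y (½ ℚ.* ε) (pos½ ε>0)) (below u≤v (½ ℚ.* ε) (pos½ ε>0))

-- The form in which most inequalities are certified: `p` is built from nonnegative factors, and the
-- remaining equation is usually an identity for the ring solver.
≤-by : ∀ {x y p} → 0ℝ ≤ p → y ≈ x + p → x ≤ y
≤-by {x} {y} {p} 0≤p y≈x+p = begin
  x       ≈⟨ R.+-identityʳ x ⟨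
  x + 0ℝ  ≤⟨ +-mono-≤ (≤-reflexive ≈-refl) 0≤p ⟩
  x + p   ≈⟨ y≈x+p ⟨
  y       ∎

≤⇒0≤ : ∀ {x y} → x ≤ y → 0ℝ ≤ y + - x
≤⇒0≤ {x} {y} x≤y = begin
  0ℝ       ≈⟨ R.-‿inverseʳ x ⟨
  x + - x  ≤⟨ +-mono-≤ x≤y (≤-reflexive ≈-refl) ⟩
  y + - x  ∎

0≤∣∣ : ∀ x → 0ℝ ≤ ∣ x ∣
0≤∣∣ x = ≤-by-terms λ n → ℚ.0≤∣p∣ (seq x n)

x≤∣x∣ : ∀ x → x ≤ ∣ x ∣
x≤∣x∣ x = ≤-by-terms λ n → p≤∣p∣ (seq x n)

∣-∣ : ∀ x → ∣ - x ∣ ≈ ∣ x ∣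
∣-∣ x = ≗⇒≈ λ n → ℚ.∣-p∣≡∣p∣ (seq x n)

∣*∣ : ∀ x y → ∣ x * y ∣ ≈ ∣ x ∣ * ∣ y ∣
∣*∣ x y = ≗⇒≈ λ n → ℚ.∣p*q∣≡∣p∣*∣q∣ (seq x n) (seq y n)

∣+∣≤ : ∀ x y → ∣ x + y ∣ ≤ ∣ x ∣ + ∣ y ∣
∣+∣≤ x y = ≤-by-terms λ n → ℚ.∣p+q∣≤∣p∣+∣q∣ (seq x n) (seq y n)

∣∣-cong : ∀ {x y} → x ≈ y → ∣ x ∣ ≈ ∣ y ∣
∣∣-cong {x} {y} x≈y = mk≈ λ ε ε>0 → let N , c = close x≈y ε ε>0 in
  N , λ n N≤n → ℚ.≤-<-trans (∣∣-nonexp (seq x n) (seq y n)) (c n N≤n)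

∣∣-least : ∀ {x y} → x ≤ y → - x ≤ y → ∣ x ∣ ≤ y
∣∣-least x≤y -x≤y = mk≤ λ ε ε>0 → eventually₂ (λ n → ∣∣-lub) (below x≤y ε ε>0) (below -x≤y ε ε>0)

0≤+ : ∀ {x y} → 0ℝ ≤ x → 0ℝ ≤ y → 0ℝ ≤ x + y
0≤+ {x} {y} 0≤x 0≤y = ≤-trans (≤-reflexive (≈-sym (R.+-identityˡ 0ℝ))) (+-mono-≤ 0≤x 0≤y)

0≤⇒∣x∣≈x : ∀ {x} → 0ℝ ≤ x → ∣ x ∣ ≈ x
0≤⇒∣x∣≈x {x} 0≤x = ≤-antisym
  (∣∣-least (≤-reflexive ≈-refl) (≤-by (0≤+ 0≤x 0≤x) (solve 1 (λ x → x := :- x :+ (x :+ x)) ≈-refl x)))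
  (x≤∣x∣ x)

-- Nonnegative reals may have slightly negative terms; passing to `∣ x ∣` and `∣ y ∣` makes the
-- product nonnegative term by term.
0≤* : ∀ {x y} → 0ℝ ≤ x → 0ℝ ≤ y → 0ℝ ≤ x * y
0≤* {x} {y} 0≤x 0≤y = begin
  0ℝ             ≤⟨ 0≤∣∣ (x * y) ⟩
  ∣ x * y ∣      ≈⟨ ∣*∣ x y ⟩
  ∣ x ∣ * ∣ y ∣  ≈⟨ *-cong (0≤⇒∣x∣≈x 0≤x) (0≤⇒∣x∣≈x 0≤y) ⟩
  x * y          ∎

∣p∣²≡p² : ∀ p → ℚ.∣ p ∣ ℚ.* ℚ.∣ p ∣ ≡ p ℚ.* p
∣p∣²≡p² p with ℚ.∣p∣≡p∨∣p∣≡-p p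
... | inj₁ eq rewrite eq = refl
... | inj₂ eq rewrite eq = ℚS.solve 1 (λ p → (ℚS.:- p) ℚS.:* (ℚS.:- p) ℚS.:= p ℚS.:* p) refl p

∣x∣²≈x² : ∀ x → ∣ x ∣ * ∣ x ∣ ≈ x * x
∣x∣²≈x² x = ≗⇒≈ λ n → ∣p∣²≡p² (seq x n)

0≤x² : ∀ x → 0ℝ ≤ x * x
0≤x² x = ≤-trans (0≤* (0≤∣∣ x) (0≤∣∣ x)) (≤-reflexive (∣x∣²≈x² x))

-- If |p| > |q| + ε, then p² > (|q| + ε)² ≥ q² + ε². A slack of ε² between squares thus becomes a
-- slack of ε between moduli, which is what `_≤_` asks for.
∣∣-sq-cancel : ∀ p q {ε} → 0ℚ ℚ.< ε → p ℚ.* p ℚ.≤ q ℚ.* q ℚ.+ ε ℚ.* ε → ℚ.∣ p ∣ ℚ.≤ ℚ.∣ q ∣ ℚ.+ ε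
∣∣-sq-cancel p q {ε} ε>0 pp≤ = ℚ.≮⇒≥ λ b<a → ℚ.<-irrefl refl
  (ℚ.<-≤-trans (sq-< b<a) (≤-resp-≡ˡ (sym (∣p∣²≡p² p)) (ℚ.≤-trans pp≤ sq-≤)))
  where
  a b : ℚ
  a = ℚ.∣ p ∣
  b = ℚ.∣ q ∣ ℚ.+ ε
  b>0 : 0ℚ ℚ.< b
  b>0 = ℚ.<-≤-trans ε>0 (≤-resp-≡ʳ (ℚ.+-comm ε ℚ.∣ q ∣) (p≤p+q ε (ℚ.0≤∣p∣ q)))
  sq-< : b ℚ.< a → b ℚ.* b ℚ.< a ℚ.* a
  sq-< b<a = ℚ.<-trans
    (ℚ.*-monoʳ-<-pos b {{ℚ.positive b>0}} b<a)
    (ℚ.*-monoˡ-<-pos a {{ℚ.positive (ℚ.<-trans b>0 b<a)}} b<a)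
  0≤2qε : 0ℚ ℚ.≤ ℚ.∣ q ∣ ℚ.* (ε ℚ.+ ε)
  0≤2qε = ℚ.nonNegative⁻¹ _ {{ℚ.nonNeg*nonNeg⇒nonNeg ℚ.∣ q ∣ {{ℚ.∣-∣-nonNeg q}} (ε ℚ.+ ε)
    {{ℚ.nonNegative (ℚ.<⇒≤ (ℚ.+-mono-< ε>0 ε>0))}}}}
  sq-≤ : q ℚ.* q ℚ.+ ε ℚ.* ε ℚ.≤ b ℚ.* b
  sq-≤ = ≤-resp-≡ʳ
    (trans (cong (λ z → z ℚ.+ ε ℚ.* ε ℚ.+ ℚ.∣ q ∣ ℚ.* (ε ℚ.+ ε)) (sym (∣p∣²≡p² q)))
      (ℚS.solve 2 (λ c e → c ℚS.:* c ℚS.:+ e ℚS.:* e ℚS.:+ c ℚS.:* (e ℚS.:+ e)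
        ℚS.:= (c ℚS.:+ e) ℚS.:* (c ℚS.:+ e)) refl ℚ.∣ q ∣ ε))
    (p≤p+q (q ℚ.* q ℚ.+ ε ℚ.* ε) 0≤2qε)

sq-cancel-∣∣ : ∀ {x y} → x * x ≤ y * y → ∣ x ∣ ≤ ∣ y ∣
sq-cancel-∣∣ {x} {y} xx≤yy = mk≤ λ ε ε>0 → let N , c = below xx≤yy (ε ℚ.* ε) (pos* ε>0 ε>0) in
  N , λ n N≤n → ∣∣-sq-cancel (seq x n) (seq y n) ε>0 (c n N≤n)

sq-cancel : ∀ {x y} → 0ℝ ≤ y → x * x ≤ y * y → x ≤ y
sq-cancel {x} {y} 0≤y xx≤yy = begin
  x      ≤⟨ x≤∣x∣ x ⟩
  ∣ x ∣  ≤⟨ sq-cancel-∣∣ xx≤yy ⟩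
  ∣ y ∣  ≈⟨ 0≤⇒∣x∣≈x 0≤y ⟩
  y      ∎

ι-cong : ∀ {p q} → p ≡ q → ι p ≈ ι q
ι-cong refl = ≈-refl

ι-* : ∀ p q → ι (p ℚ.* q) ≈ ι p * ι q
ι-* p q = ≗⇒≈ λ _ → refl

ι-mono-≤ : ∀ {p q} → p ℚ.≤ q → ι p ≤ ι q
ι-mono-≤ p≤q = ≤-by-terms λ _ → p≤q

*-mono-≤ : ∀ {x y u v} → 0ℝ ≤ x → 0ℝ ≤ u → x ≤ y → u ≤ v → x * u ≤ y * v
*-mono-≤ {x} {y} {u} {v} 0≤x 0≤u x≤y u≤v = ≤-by
  (0≤+ (0≤* 0≤x (≤⇒0≤ u≤v)) (0≤* (≤⇒0≤ x≤y) (≤-trans 0≤u u≤v)))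
  (solve 4 (λ x y u v → y :* v := x :* u :+ (x :* (v :- u) :+ (y :- x) :* v)) ≈-refl x y u v)

<⇒≤ : ∀ {x y} → x < y → x ≤ y
<⇒≤ {x} (mk< η η>0 (N , sep)) = mk≤ λ ε ε>0 → N , λ n N≤n →
  ℚ.≤-trans (ℚ.≤-trans (p≤p+q (seq x n) (ℚ.<⇒≤ η>0)) (sep n N≤n)) (p≤p+q _ (ℚ.<⇒≤ ε>0))

≤-<-trans : ∀ {x y z} → x ≤ y → y < z → x < z
≤-<-trans {x} {y} {z} x≤y (mk< η η>0 sep) = mk< (½ ℚ.* η) (pos½ η>0) (eventually₂
  (λ n xy yz → ℚ.≤-trans (ℚ.+-monoˡ-≤ (½ ℚ.* η) xy)
    (≤-resp-≡ˡ (sym (+-halves (seq y n) η)) yz))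
  (below x≤y (½ ℚ.* η) (pos½ η>0)) sep)

<-≤-trans : ∀ {x y z} → x < y → y ≤ z → x < z
<-≤-trans {x} {y} {z} (mk< η η>0 sep) y≤z = mk< (½ ℚ.* η) (pos½ η>0) (eventually₂
  (λ n xy yz → +-cancelʳ-≤ (½ ℚ.* η) (≤-resp-≡ˡ (sym (+-halves (seq x n) η)) (ℚ.≤-trans xy yz)))
  sep (below y≤z (½ ℚ.* η) (pos½ η>0)))
  where
  +-cancelʳ-≤ : ∀ r {p q} → p ℚ.+ r ℚ.≤ q ℚ.+ r → p ℚ.≤ q
  +-cancelʳ-≤ r {p} {q} p+r≤q+r = subst₂ ℚ._≤_ (cancel p r) (cancel q r) (ℚ.+-monoˡ-≤ (ℚ.- r) p+r≤q+r)
    where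
    cancel : ∀ p r → p ℚ.+ r ℚ.- r ≡ p
    cancel = ℚS.solve 2 (λ p r → p ℚS.:+ r ℚS.:- r ℚS.:= p) refl

ι-mono-< : ∀ {p q} → p ℚ.< q → ι p < ι q
ι-mono-< {p} {q} p<q = mk< (q ℚ.- p) (≤-<-0 p<q) (0 , λ _ _ → ℚ.≤-reflexive (add-sub q p))
  where
  ≤-<-0 : p ℚ.< q → 0ℚ ℚ.< q ℚ.- p
  ≤-<-0 p<q = <-resp-≡ˡ (ℚ.+-inverseʳ p) (ℚ.+-monoˡ-< (ℚ.- p) p<q)

<-irrefl : ∀ {x} → x < x → ⊥
<-irrefl {x} (mk< η η>0 (N , sep)) = ℚ.<-irrefl refl (ℚ.<-≤-trans
  (<-resp-≡ˡ (ℚ.+-identityʳ (seq x N)) (ℚ.+-monoʳ-< (seq x N) η>0)) (sep N ℕ.≤-refl))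

0<⇒#0 : ∀ {x} → 0ℝ < x → x #0
0<⇒#0 {x} (mk< η η>0 (N , sep)) = mk#0 η η>0 (N , λ n N≤n →
  ℚ.≤-trans (≤-resp-≡ˡ (ℚ.+-identityˡ η) (sep n N≤n)) (p≤∣p∣ (seq x n)))

inverse-nonNeg : ∀ {x y} → 0ℝ ≤ x → x * y ≈ 1ℝ → 0ℝ ≤ y
inverse-nonNeg {x} {y} 0≤x xy≈1 = begin
  0ℝ           ≤⟨ 0≤* 0≤x (0≤x² y) ⟩
  x * (y * y)  ≈⟨ R.*-assoc x y y ⟨
  (x * y) * y  ≈⟨ *-cong xy≈1 ≈-refl ⟩
  1ℝ * y       ≈⟨ R.*-identityˡ y ⟩
  y            ∎

inverse : ∀ {x} → 0ℝ < x → ∃ λ y → x * y ≈ 1ℝ × 0ℝ ≤ y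
inverse {x} 0<x = let x#0 = 0<⇒#0 0<x in
  recip x x#0 , recip-inverse x x#0 , inverse-nonNeg (<⇒≤ 0<x) (recip-inverse x x#0)

+-monoˡ-< : ∀ {x y} z → x < y → x + z < y + z
+-monoˡ-< {x} {y} z (mk< η η>0 (N , sep)) = mk< η η>0 (N , λ n N≤n → ≤-resp-≡ˡ
  (ℚS.solve 3 (λ p q e → (p ℚS.:+ e) ℚS.:+ q ℚS.:= (p ℚS.:+ q) ℚS.:+ e) refl (seq x n) (seq z n) η)
  (ℚ.+-monoˡ-≤ (seq z n) (sep n N≤n)))

+-cancelʳ-< : ∀ {x y} z → x + z < y + z → x < y
+-cancelʳ-< {x} {y} z x+z<y+z = ≤-<-trans (≤-reflexive (cancel x z))
  (<-≤-trans (+-monoˡ-< (- z) x+z<y+z) (≤-reflexive (≈-sym (cancel y z))))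
  where
  cancel : ∀ x z → x ≈ (x + z) + - z
  cancel = solve 2 (λ x z → x := (x :+ z) :- z) ≈-refl

sq≤0⇒≈0 : ∀ {x} → x * x ≤ 0ℝ → x ≈ 0ℝ
sq≤0⇒≈0 {x} xx≤0 = ≤-antisym (root x xx≤0)
  (≤-by (≤⇒0≤ (root (- x) (≤-trans (≤-reflexive (solve 1 (λ x → :- x :* :- x
        := x :* x) ≈-refl x)) xx≤0)))
    (solve 1 (λ x → x := con 0ℚ :+ (con 0ℚ :- :- x)) ≈-refl x))
  where
  root : ∀ y → y * y ≤ 0ℝ → y ≤ 0ℝ
  root y yy≤0 = sq-cancel (≤-reflexive ≈-refl)
    (≤-trans yy≤0 (≤-reflexive (≈-sym (R.zeroˡ 0ℝ))))

0<⇒ι≤ : ∀ {x} → 0ℝ < x → ∃ λ η → 0ℚ ℚ.< η × ι η ≤ x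
0<⇒ι≤ {x} (mk< η η>0 (N , sep)) = η , η>0 , mk≤ λ ε ε>0 → N , λ n N≤n →
  ℚ.≤-trans (≤-resp-≡ˡ (ℚ.+-identityˡ η) (sep n N≤n)) (p≤p+q (seq x n) (ℚ.<⇒≤ ε>0))

0<* : ∀ {x y} → 0ℝ < x → 0ℝ < y → 0ℝ < x * y
0<* {x} {y} 0<x 0<y =
  let η , η>0 , η≤x = 0<⇒ι≤ 0<x
      θ , θ>0 , θ≤y = 0<⇒ι≤ 0<y
  in <-≤-trans (ι-mono-< (pos* η>0 θ>0)) (≤-trans (≤-reflexive (ι-* η θ))
       (*-mono-≤ {ι η} {x} {ι θ} {y} (ι-mono-≤ (ℚ.<⇒≤ η>0)) (ι-mono-≤ (ℚ.<⇒≤ θ>0)) η≤x θ≤y))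

<⇒0< : ∀ {x y} → x < y → 0ℝ < y + - x
<⇒0< {x} x<y = ≤-<-trans (≤-reflexive (≈-sym (R.-‿inverseʳ x))) (+-monoˡ-< (- x) x<y)

<-by : ∀ {x y p} → 0ℝ < p → y ≈ x + p → x < y
<-by {x} {y} {p} 0<p y≈x+p = ≤-<-trans (≤-reflexive (≈-sym (R.+-identityˡ x)))
  (<-≤-trans (+-monoˡ-< x 0<p) (≤-reflexive (≈-trans (R.+-comm p x) (≈-sym y≈x+p))))

0≤ι : ∀ p .{{_ : ℚ.NonNegative p}} → 0ℝ ≤ ι p
0≤ι p = ι-mono-≤ (ℚ.nonNegative⁻¹ p)

-- Strict positivity requires a rational gap. An upper bound `b` of `y` supplies one: x = xy/b + x(b
-- - y)/b ≥ 1/b.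
inverse-pos : ∀ {x y} → 0ℝ ≤ x → x * y ≈ 1ℝ → 0ℝ < x
inverse-pos {x} {y} 0≤x xy≈1 =
  let b , b>0 , N , y≤b = bounded y
      instance
        b-pos : ℚ.Positive b
        b-pos = ℚ.positive b>0
        b≢0 : ℚ.NonZero b
        b≢0 = ℚ.pos⇒nonZero b
      c = ℚ.1/ b
      c>0 = ℚ.positive⁻¹ c {{ℚ.1/pos⇒pos b}}
      y≤ιb = mk≤ λ ε ε>0 → N , λ n N≤n →
        ℚ.≤-trans (p≤∣p∣ (seq y n)) (ℚ.≤-trans (y≤b n N≤n) (p≤p+q b (ℚ.<⇒≤ ε>0)))
  in <-≤-trans (ι-mono-< c>0) (≤-by
       (0≤* (0≤* 0≤x (ι-mono-≤ (ℚ.<⇒≤ c>0))) (≤⇒0≤ {y} {ι b} y≤ιb))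
       (begin-equality
         x                                      ≈⟨ solve 1 (λ x → x := x :* con 1ℚ) ≈-refl x ⟩
         x * 1ℝ
           ≈⟨ *-cong ≈-refl (≈-trans (ι-cong (sym (ℚ.*-inverseʳ b))) (ι-* b c)) ⟩
         x * (ι b * ι c)
           ≈⟨ solve 4 (λ x y b c → x :* (b :* c)
                 := x :* y :* c :+ x :* c :* (b :- y)) ≈-refl x y (ι b) (ι c) ⟩
         (x * y) * ι c + (x * ι c) * (ι b + - y)
           ≈⟨ +-cong (≈-trans (*-cong xy≈1 ≈-refl) (R.*-identityˡ (ι c))) ≈-refl ⟩
         ι c + (x * ι c) * (ι b + - y)            ∎))

⊔-least : ∀ {x y z} → x ≤ z → y ≤ z → x ⊔ y ≤ z
⊔-least x≤z y≤z = mk≤ λ ε ε>0 → eventually₂ (λ _ → ℚ.⊔-lub) (below x≤z ε ε>0) (below y≤z ε ε>0)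

-- The hypothesis `0ℝ ≤ z` accounts for the start value of the fold.
maxℝ-least : ∀ {n} (f : Vector ℝ n) {z} → 0ℝ ≤ z → (∀ i → f i ≤ z) → maxℝ f ≤ z
maxℝ-least {zero}  f 0≤z f≤z = 0≤z
maxℝ-least {suc n} f 0≤z f≤z = ⊔-least (f≤z zero) (maxℝ-least (f ∘ suc) 0≤z (f≤z ∘ suc))

-- Square roots

/-*-/ : ∀ a b c d → (a ℚ./ suc b) ℚ.* (c ℚ./ suc d) ≡ (a ℤ.* c) ℚ./ (suc b ℕ.* suc d)
/-*-/ a b c d = ℚ.toℚᵘ-injective
  (ℚᵘ.≃-trans (ℚ.toℚᵘ-homo-* (a ℚ./ suc b) (c ℚ./ suc d))
  (ℚᵘ.≃-trans (ℚᵘ.*-cong (ℚ.toℚᵘ-fromℚᵘ (ℚᵘ.mkℚᵘ a b)) (ℚ.toℚᵘ-fromℚᵘ (ℚᵘ.mkℚᵘ c d)))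
    (ℚᵘ.≃-sym (ℚ.toℚᵘ-fromℚᵘ (ℚᵘ.mkℚᵘ a b ℚᵘ.* ℚᵘ.mkℚᵘ c d)))))

/1-+ : ∀ a b → (a ℤ.+ b) ℚ./ 1 ≡ a ℚ./ 1 ℚ.+ b ℚ./ 1
/1-+ a b = ℚ.toℚᵘ-injective
  (ℚᵘ.≃-trans (ℚ.toℚᵘ-fromℚᵘ (ℚᵘ.mkℚᵘ (a ℤ.+ b) 0))
  (ℚᵘ.≃-trans (ℚᵘ.*≡* (cong (ℤ._* 1ℤ) (sym (cong₂ ℤ._+_ (ℤ.*-identityʳ a) (ℤ.*-identityʳ b)))))
  (ℚᵘ.≃-trans (ℚᵘ.+-cong (ℚᵘ.≃-sym (ℚ.toℚᵘ-fromℚᵘ (ℚᵘ.mkℚᵘ a 0)))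
                         (ℚᵘ.≃-sym (ℚ.toℚᵘ-fromℚᵘ (ℚᵘ.mkℚᵘ b 0))))
    (ℚᵘ.≃-sym (ℚ.toℚᵘ-homo-+ (a ℚ./ 1) (b ℚ./ 1))))))

fromℤ : ℤ → ℝ
fromℤ a = ι (a ℚ./ 1)

fromℕ : ℕ → ℝ
fromℕ n = fromℤ (+ n)

fromℤ-+ : ∀ a b → fromℤ (a ℤ.+ b) ≈ fromℤ a + fromℤ b
fromℤ-+ a b = ≗⇒≈ λ _ → /1-+ a b

fromℤ-* : ∀ a b → fromℤ (a ℤ.* b) ≈ fromℤ a * fromℤ b
fromℤ-* a b = ≗⇒≈ λ _ → sym (/-*-/ a 0 b 0)

fromℕ-+ : ∀ m n → fromℕ (m ℕ.+ n) ≈ fromℕ m + fromℕ n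
fromℕ-+ m n = fromℤ-+ (+ m) (+ n)

fromℕ-* : ∀ m n → fromℕ (m ℕ.* n) ≈ fromℕ m * fromℕ n
fromℕ-* m n = ≈-trans (ι-cong (cong (ℚ._/ 1) (ℤ.pos-* m n))) (fromℤ-* (+ m) (+ n))

fromℕ-mono-≤ : ∀ {m n} → m ℕ.≤ n → fromℕ m ≤ fromℕ n
fromℕ-mono-≤ {m} {n} m≤n = ι-mono-≤ (/-mono-≤ m 0 n 0 (ℕ.*-monoˡ-≤ 1 m≤n))

fromℕ-mono-< : ∀ {m n} → m ℕ.< n → fromℕ m < fromℕ n
fromℕ-mono-< {m} {n} m<n = ι-mono-< (/-mono-< m 0 n 0 (ℕ.*-monoˡ-< 1 m<n))

√-approx²≤ : ∀ k j → √-approx k j ℚ.* √-approx k j ℚ.≤ + k ℚ./ 1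
√-approx²≤ k j = ≤-resp-≡ˡ
  (trans (cong (ℚ._/ (suc j ℕ.* suc j)) (ℤ.pos-* a a)) (sym (/-*-/ (+ a) j (+ a) j)))
  (/-mono-≤ (a ℕ.* a) _ k 0 (subst (ℕ._≤ k ℕ.* (suc j ℕ.* suc j)) (sym (ℕ.*-identityʳ (a ℕ.* a)))
    (⌊√⌋-lower (k ℕ.* (suc j ℕ.* suc j)))))
  where
  a : ℕ
  a = √numer k j

≤√-approx⁺² : ∀ k j → let q = √-approx k j ℚ.+ 1ℤ ℚ./ suc j in + k ℚ./ 1 ℚ.≤ q ℚ.* q
≤√-approx⁺² k j = ≤-resp-≡ʳ
  (trans (cong (ℚ._/ (suc j ℕ.* suc j)) (ℤ.pos-* (suc a) (suc a)))
  (trans (sym (/-*-/ (+ suc a) j (+ suc a) j)) (cong₂ ℚ._*_ (/-suc a j) (/-suc a j))))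
  (/-mono-≤ k 0 (suc a ℕ.* suc a) _ (subst (k ℕ.* (suc j ℕ.* suc j) ℕ.≤_) (sym (ℕ.*-identityʳ (suc a ℕ.* suc a)))
    (ℕ.<⇒≤ (⌊√⌋-upper (k ℕ.* (suc j ℕ.* suc j))))))
  where
  a : ℕ
  a = √numer k j

-- With q the truncation of the root to multiples of h = 1/(j+1), one has q² ≤ k ≤ (q + h)², and the
-- modulus of continuity of multiplication brings the two squares within ε.
√-sq : ∀ k → √ k * √ k ≈ fromℕ k
√-sq k = ≤-antisym (≤-by-terms (√-approx²≤ k)) (mk≤ λ ε ε>0 →
  let b , b>0 , √≤b = bounded (√ k)
      -- A common radius for `q` and `q + h`, since `h` is eventually below 1.
      c = b ℚ.+ 1ℚ
      b≤c = p≤p+q b (ℚ.nonNegative⁻¹ 1ℚ)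
      c>0 = ℚ.<-≤-trans b>0 b≤c
      δ = *-modulus c ε c>0
      small = archimedean δ (*-modulus>0 c>0 ε>0)
      tiny = archimedean 1ℚ (ℚ.positive⁻¹ 1ℚ)
  in eventually₂
    (λ j √≤ (h<δ , h<1) →
      let q = √-approx k j
          h = 1ℤ ℚ./ suc j
          ∣h∣ = ℚ.0≤p⇒∣p∣≡p (ℚ.<⇒≤ (/-mono-< 0 0 1 j (ℕ.s≤s ℕ.z≤n)))
          shift = <-resp-≡ˡ (sym (trans (cong ℚ.∣_∣ (ℚS.solve 2 (λ q h → q ℚS.:- (q ℚS.:+ h) ℚS.:= ℚS.:- h) refl q h))
                    (trans (ℚ.∣-p∣≡∣p∣ h) ∣h∣))) h<δ
      in ℚ.≤-trans (≤√-approx⁺² k j) (ℚ.≤-trans (p≤q+dist ((q ℚ.+ h) ℚ.* (q ℚ.+ h)) (q ℚ.* q))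
        (ℚ.+-monoʳ-≤ (q ℚ.* q) (≤-resp-≡ˡ (dist-sym (q ℚ.* q) ((q ℚ.+ h) ℚ.* (q ℚ.+ h))) (ℚ.<⇒≤
          (*-close {c} {ε} c>0 q q (q ℚ.+ h) (q ℚ.+ h) (ℚ.≤-trans √≤ b≤c)
            (ℚ.≤-trans (ℚ.∣p+q∣≤∣p∣+∣q∣ q h) (ℚ.+-mono-≤ √≤ (≤-resp-≡ˡ (sym ∣h∣) (ℚ.<⇒≤ h<1))))
            shift shift))))))
    √≤b (eventually₂ (λ _ → _,_) small tiny))

1≤√ : ∀ k .{{_ : NonZero k}} → 1ℝ ≤ √ k
1≤√ k = ≤-by-terms λ j → 1≤√-approx k j

-- Orthonormal rows

open Algebra.Properties.Semiring.Sum R.semiring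
  using (sum-remove; sum-cong-≋; sum-replicate-zero; *-distribˡ-sum; *-distribʳ-sum; ∑-comm; ∑-distrib-+)

sum-zero : ∀ {n} (f : Vector ℝ n) → (∀ i → f i ≈ 0ℝ) → sumℝ f ≈ 0ℝ
sum-zero {n} f f≈0 = ≈-trans (sum-cong-≋ f≈0) (sum-replicate-zero n)

sum-nonNeg : ∀ {n} (f : Vector ℝ n) → (∀ i → 0ℝ ≤ f i) → 0ℝ ≤ sumℝ f
sum-nonNeg {zero}  f 0≤f = ≤-reflexive ≈-refl
sum-nonNeg {suc n} f 0≤f = 0≤+ (0≤f zero) (sum-nonNeg (f ∘ suc) (0≤f ∘ suc))

term≤sum : ∀ {n} (f : Vector ℝ n) → (∀ i → 0ℝ ≤ f i) → ∀ i → f i ≤ sumℝ f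
term≤sum {suc n} f 0≤f i = ≤-by (sum-nonNeg (f ∘ punchIn i) (0≤f ∘ punchIn i)) (sum-remove {i = i} f)

-- A pigeonhole principle without decidable order: cotransitivity at `c + sumℝ (f ∘ suc)` either
-- certifies the first term or passes the strict excess on to the tail. On the empty sum the excess
-- would read 0 < 0.
large-term : ∀ {n} (f : Vector ℝ n) c → fromℕ n * c < sumℝ f → ∃ λ j → c ≤ f j
large-term {zero} f c 0<0 = ⊥-elim (<-irrefl (≤-<-trans (≤-reflexive (≈-sym (R.zeroˡ c))) 0<0))
large-term {suc n} f c nc<f with <-cotrans nc<f (c + sumℝ (f ∘ suc))
... | inj₂ c<f₀ = zero , <⇒≤ (+-cancelʳ-< (sumℝ (f ∘ suc)) c<f₀)
... | inj₁ nc<f′ =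
  let j , c≤fj = large-term (f ∘ suc) c (+-cancelʳ-< c (≤-<-trans (≤-reflexive nc+c)
                   (<-≤-trans nc<f′ (≤-reflexive (R.+-comm c _)))))
  in suc j , c≤fj
  where
  nc+c : fromℕ n * c + c ≈ fromℕ (suc n) * c
  nc+c = ≈-trans (solve 2 (λ n c → n :* c :+ c := (con 1ℚ :+ n) :* c) ≈-refl (fromℕ n) c)
    (*-cong (≈-sym (fromℕ-+ 1 n)) ≈-refl)

δ-refl : ∀ {n} (i : Fin n) → δ i i ≈ 1ℝ
δ-refl i with i Fin.≟ i
... | yes _   = ≈-refl
... | no  i≢i = contradiction refl i≢i

δ-suc : ∀ {n} (i j : Fin n) → δ (suc i) (suc j) ≈ δ i j
δ-suc i j with i Fin.≟ j
... | yes _ = ≈-refl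
... | no  _ = ≈-refl

δ-sum : ∀ {n} (j : Fin n) (f : Vector ℝ n) → sumℝ (λ i → f i * δ i j) ≈ f j
δ-sum {suc n} zero f = ≈-trans
  (+-cong (R.*-identityʳ (f zero)) (sum-zero _ λ i → R.zeroʳ (f (suc i))))
  (R.+-identityʳ (f zero))
δ-sum {suc n} (suc j) f = ≈-trans
  (+-cong (R.zeroʳ (f zero))
    (≈-trans (sum-cong-≋ λ i → *-cong ≈-refl (δ-suc i j)) (δ-sum j (f ∘ suc))))
  (R.+-identityˡ (f (suc j)))

infix 8 _·_

_·_ : ∀ {n} → Vector ℝ n → Vector ℝ n → ℝ
x · y = sumℝ (λ l → x l * y l)

·-comm : ∀ {n} (x y : Vector ℝ n) → x · y ≈ y · x
·-comm x y = sum-cong-≋ λ l → R.*-comm (x l) (y l)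

·-rank-one : ∀ {n} (x y z : Vector ℝ n) α β →
  (λ l → x l + - (α * z l)) · (λ l → y l + - (β * z l)) ≈
  x · y + - (β * x · z) + - (α * y · z) + (α * β) * z · z
·-rank-one {zero} x y z α β =
  solve 2 (λ α β → con 0ℚ := con 0ℚ :- β :* con 0ℚ :- α :* con 0ℚ :+ α :* β :* con 0ℚ) ≈-refl α β
·-rank-one {suc n} x y z α β = ≈-trans (+-cong ≈-refl (·-rank-one (x ∘ suc) (y ∘ suc) (z ∘ suc) α β))
  (solve 9 (λ x y z α β xy xz yz zz →
      (x :- α :* z) :* (y :- β :* z) :+ (xy :- β :* xz :- α :* yz :+ α :* β :* zz)
      := (x :* y :+ xy) :- β :* (x :* z :+ xz) :- α :* (y :* z :+ yz) :+ α :* β :* (z :* z :+ zz))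
    ≈-refl (x zero) (y zero) (z zero) α β
    ((x ∘ suc) · (y ∘ suc)) ((x ∘ suc) · (z ∘ suc)) ((y ∘ suc) · (z ∘ suc)) ((z ∘ suc) · (z ∘ suc)))

-- Orthonormal rows force orthonormal columns

RowsOrthonormal : ∀ {n} → SquareMatrix ℝ n → Set
RowsOrthonormal U = ∀ i j → U i · U j ≈ δ i j

infix 9 _ᵀ∙_

_ᵀ∙_ : ∀ {n} → SquareMatrix ℝ n → Vector ℝ n → Vector ℝ n
(U ᵀ∙ y) i = sumℝ (λ l → y l * U l i)

ᵀ∙-adjoint : ∀ {n} (U : SquareMatrix ℝ n) x y → U ᵀ∙ y · x ≈ sumℝ (λ l → y l * U l · x)
ᵀ∙-adjoint U x y = begin-equality
  sumℝ (λ i → sumℝ (λ l → y l * U l i) * x i)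
    ≈⟨ (sum-cong-≋ λ i → *-distribʳ-sum (x i) (λ l → y l * U l i)) ⟩
  sumℝ (λ i → sumℝ (λ l → y l * U l i * x i))
    ≈⟨ ∑-comm (λ i l → y l * U l i * x i) ⟩
  sumℝ (λ l → sumℝ (λ i → y l * U l i * x i))
    ≈⟨ (sum-cong-≋ λ l → sum-cong-≋ λ i → R.*-assoc (y l) (U l i) (x i)) ⟩
  sumℝ (λ l → sumℝ (λ i → y l * (U l i * x i)))
    ≈⟨ (sum-cong-≋ λ l → *-distribˡ-sum (y l) (λ i → U l i * x i)) ⟨
  sumℝ (λ l → y l * U l · x) ∎

module _ {n} {U : SquareMatrix ℝ n} (orth : RowsOrthonormal U) where

  row·ᵀ∙ : ∀ l y → U l · (U ᵀ∙ y) ≈ y l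
  row·ᵀ∙ l y = begin-equality
    U l · (U ᵀ∙ y)                 ≈⟨ ·-comm (U l) (U ᵀ∙ y) ⟩
    U ᵀ∙ y · U l                   ≈⟨ ᵀ∙-adjoint U (U l) y ⟩
    sumℝ (λ k → y k * U k · U l)   ≈⟨ (sum-cong-≋ λ k → *-cong ≈-refl (orth k l)) ⟩
    sumℝ (λ k → y k * δ k l)       ≈⟨ δ-sum l y ⟩
    y l                            ∎

  -- Because UUᵀ = I, |Uᵀy|² = y · UUᵀy = |y|².
  ᵀ∙-isometry : ∀ y → U ᵀ∙ y · U ᵀ∙ y ≈ y · y
  ᵀ∙-isometry y = ≈-trans (ᵀ∙-adjoint U (U ᵀ∙ y) y)
    (sum-cong-≋ λ l → *-cong ≈-refl (row·ᵀ∙ l y))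

  private
    col : Fin n → Vector ℝ n
    col j l = U l j

    gram : Fin n → Vector ℝ n
    gram j = U ᵀ∙ col j

    defect : Fin n → Vector ℝ n
    defect j i = gram j i + - δ i j

  -- The squared norms 1 - gram j j of the columns of UᵀU - I are nonnegative
  -- and sum to 0, so all these columns vanish.
  defect-norm : ∀ j → defect j · defect j ≈ 1ℝ + - gram j j
  defect-norm j = begin-equality
    defect j · defect j
      ≈⟨ (sum-cong-≋ λ i → solve 2 (λ g d → (g :- d) :* (g :- d) := g :* g :+ (d :- (g :+ g)) :* d)
            ≈-refl (gram j i) (δ i j)) ⟩
    sumℝ (λ i → gram j i * gram j i + (δ i j + - (gram j i + gram j i)) * δ i j)
      ≈⟨ ∑-distrib-+ (λ i → gram j i * gram j i) (λ i → (δ i j + - (gram j i + gram j i)) * δ i j) ⟩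
    gram j · gram j + sumℝ (λ i → (δ i j + - (gram j i + gram j i)) * δ i j)
      ≈⟨ +-cong (ᵀ∙-isometry (col j)) (δ-sum j (λ i → δ i j + - (gram j i + gram j i))) ⟩
    gram j j + (δ j j + - (gram j j + gram j j))
      ≈⟨ +-cong ≈-refl (+-cong (δ-refl j) ≈-refl) ⟩
    gram j j + (1ℝ + - (gram j j + gram j j))
      ≈⟨ solve 1 (λ g → g :+ (con 1ℚ :- (g :+ g)) := con 1ℚ :- g) ≈-refl (gram j j) ⟩
    1ℝ + - gram j j ∎

  -- Exchanging two sums shows that UᵀU and UUᵀ = I have the same trace. Squareness of U enters
  -- here: the number of rows, which is that trace, also counts the columns.
  trace-defect : sumℝ (λ j → 1ℝ + - gram j j) ≈ 0ℝ
  trace-defect = begin-equality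
    D            ≈⟨ solve 2 (λ d t → d := (d :+ t) :- t) ≈-refl D T ⟩
    (D + T) + - T ≈⟨ +-cong D+T ≈-refl ⟩
    I + - T      ≈⟨ +-cong ≈-refl (-‿cong T≈I) ⟩
    I + - I      ≈⟨ R.-‿inverseʳ I ⟩
    0ℝ           ∎
    where
    D T I : ℝ
    D = sumℝ (λ j → 1ℝ + - gram j j)
    T = sumℝ (λ j → gram j j)
    I = sumℝ {n} (λ _ → 1ℝ)
    D+T : D + T ≈ I
    D+T = ≈-trans (≈-sym (∑-distrib-+ (λ j → 1ℝ + - gram j j) (λ j → gram j j)))
      (sum-cong-≋ λ j → solve 1 (λ g → (con 1ℚ :- g) :+ g := con 1ℚ) ≈-refl (gram j j))
    T≈I : T ≈ I
    T≈I = ≈-trans (∑-comm (λ j l → U l j * U l j)) (sum-cong-≋ λ l → ≈-trans (orth l l) (δ-refl l))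

  rows⇒columns : ∀ i j → sumℝ (λ l → U l i * U l j) ≈ δ i j
  rows⇒columns i j = begin-equality
    sumℝ (λ l → U l i * U l j)  ≈⟨ (sum-cong-≋ λ l → R.*-comm (U l i) (U l j)) ⟩
    gram j i                    ≈⟨ solve 2 (λ g d → g := (g :- d) :+ d) ≈-refl (gram j i) (δ i j) ⟩
    defect j i + δ i j          ≈⟨ +-cong (sq≤0⇒≈0 defect²≤0) ≈-refl ⟩
    0ℝ + δ i j                  ≈⟨ R.+-identityˡ (δ i j) ⟩
    δ i j                       ∎
    where
    norm≥0 : ∀ k → 0ℝ ≤ defect k · defect k
    norm≥0 k = sum-nonNeg _ λ l → 0≤x² (defect k l)
    defect²≤0 : defect j i * defect j i ≤ 0ℝ
    defect²≤0 = begin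
      defect j i * defect j i         ≤⟨ term≤sum _ (λ l → 0≤x² (defect j l)) i ⟩
      defect j · defect j             ≈⟨ defect-norm j ⟩
      1ℝ + - gram j j
        ≤⟨ term≤sum _ (λ k → ≤-trans (norm≥0 k) (≤-reflexive (defect-norm k))) j ⟩
      sumℝ (λ k → 1ℝ + - gram k k)    ≈⟨ trace-defect ⟩
      0ℝ                              ∎

  isOrthogonal : IsOrthogonal U
  isOrthogonal = record { rows-orthonormal = orth ; columns-orthonormal = rows⇒columns }

-- The rank-one reduction

reduce : ∀ {n} → SquareMatrix ℝ (suc n) → Fin (suc n) → ℝ → SquareMatrix ℝ n
reduce U j κ i l = U (suc i) (punchIn j l) + - ((κ * U (suc i) j) * U zero (punchIn j l))

-- The full rows being orthonormal, the truncated ones satisfy `xy` = δ - cc′, `xz` = -ca, `yz` =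
-- -c′a, `zz` = 1 - a². Expanding the new inner product leaves δ + cc′(2aκ + κ²(1 - a²) - 1), and
-- the equation for κ removes the second term.
reduce-orthonormal : ∀ {n} {U : SquareMatrix ℝ (suc n)} → RowsOrthonormal U → ∀ j κ →
  let a = U zero j in (a + a) * κ + (κ * κ) * (1ℝ + - (a * a)) ≈ 1ℝ →
  RowsOrthonormal (reduce U j κ)
reduce-orthonormal {U = U} orth j κ κ-eq i i′ = begin-equality
  reduce U j κ i · reduce U j κ i′
    ≈⟨ ·-rank-one (row (suc i)) (row (suc i′)) (row zero) (κ * c) (κ * c′) ⟩
  xy + - ((κ * c′) * xz) + - ((κ * c) * yz) + ((κ * c) * (κ * c′)) * zz
    -- Regrouped so that each truncated product is completed by its `j`-th term and `split` applies.
    ≈⟨ solve 8 (λ κ a c c′ xy xz yz zz →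
         xy :- κ :* c′ :* xz :- κ :* c :* yz :+ κ :* c :* (κ :* c′) :* zz
         := c :* c′ :* ((a :+ a) :* κ :+ κ :* κ :* (con 1ℚ :- a :* a)) :- c :* c′
            :+ (c :* c′ :+ xy) :- κ :* c′ :* (c :* a :+ xz) :- κ :* c :* (c′ :* a :+ yz)
            :+ κ :* κ :* (c :* c′) :* (a :* a :+ zz) :- κ :* κ :* (c :* c′))
         ≈-refl κ a c c′ xy xz yz zz ⟩
  (c * c′) * ((a + a) * κ + (κ * κ) * (1ℝ + - (a * a))) + - (c * c′)
    + (c * c′ + xy) + - ((κ * c′) * (c * a + xz)) + - ((κ * c) * (c′ * a + yz))
    + ((κ * κ) * (c * c′)) * (a * a + zz) + - ((κ * κ) * (c * c′))
    ≈⟨ +-cong (+-cong (+-cong (+-cong (+-cong (+-cong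
         (*-cong ≈-refl κ-eq) ≈-refl)
         (split (suc i) (suc i′)))
         (-‿cong (*-cong ≈-refl (split (suc i) zero))))
         (-‿cong (*-cong ≈-refl (split (suc i′) zero))))
         (*-cong ≈-refl (split zero zero))) ≈-refl ⟩
  (c * c′) * 1ℝ + - (c * c′) + δ (suc i) (suc i′) + - ((κ * c′) * 0ℝ) + - ((κ * c) * 0ℝ)
    + ((κ * κ) * (c * c′)) * 1ℝ + - ((κ * κ) * (c * c′))
    ≈⟨ solve 4 (λ κ c c′ d → c :* c′ :* con 1ℚ :- c :* c′ :+ d :- κ :* c′ :* con 0ℚ :- κ :* c :* con 0ℚ
         :+ κ :* κ :* (c :* c′) :* con 1ℚ :- κ :* κ :* (c :* c′)
               := d) ≈-refl κ c c′ (δ (suc i) (suc i′)) ⟩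
  δ (suc i) (suc i′)
    ≈⟨ δ-suc i i′ ⟩
  δ i i′ ∎
  where
  row : ∀ k → Vector ℝ _
  row k = U k ∘ punchIn j
  a c c′ xy xz yz zz : ℝ
  a = U zero j
  c = U (suc i) j
  c′ = U (suc i′) j
  xy = row (suc i) · row (suc i′)
  xz = row (suc i) · row zero
  yz = row (suc i′) · row zero
  zz = row zero · row zero
  split : ∀ k l → U k j * U l j + row k · row l ≈ δ k l
  split k l = ≈-trans (≈-sym (sum-remove {i = j} (λ m → U k m * U l m))) (orth k l)

-- Reducing the order

-- `feedback a κ` minus 1 factors as (κ(1+a) - 1)(κ(1-a) + 1), so one polynomial equation covers
-- both signs of the pivot.
feedback : ℝ → ℝ → ℝ
feedback a κ = (a + a) * κ + (κ * κ) * (1ℝ + - (a * a))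

module _ {r w : ℝ} (0<r : 0ℝ < r) (rw : (1ℝ + r) * w ≈ 1ℝ) (0≤w : 0ℝ ≤ w) where

  private
    0≤r : 0ℝ ≤ r
    0≤r = <⇒≤ 0<r

  -- Here κ = 1/(1+a), and `w` = 1/(1+r) exceeds it by κ w (a - r).
  feedback-above : ∀ {a} → r ≤ a → ∃ λ κ → feedback a κ ≈ 1ℝ × ∣ κ ∣ ≤ w
  feedback-above {a} r≤a =
    let 1≤1+a = ≤-by {1ℝ} {1ℝ + a} (≤-trans 0≤r r≤a) ≈-refl
        h , 1+a*h , 0≤h = inverse (<-≤-trans (ι-mono-< (ℚ.positive⁻¹ 1ℚ)) 1≤1+a)
    in h
     , (begin-equality
         feedback a h
           ≈⟨ solve 2 (λ a h → (a :+ a) :* h :+ h :* h :* (con 1ℚ :- a :* a)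
                := (a :+ a) :* h :+ h :* (con 1ℚ :- a) :* ((con 1ℚ :+ a) :* h)) ≈-refl a h ⟩
         (a + a) * h + (h * (1ℝ + - a)) * ((1ℝ + a) * h)
           ≈⟨ +-cong ≈-refl (*-cong ≈-refl 1+a*h) ⟩
         (a + a) * h + (h * (1ℝ + - a)) * 1ℝ
           ≈⟨ solve 2 (λ a h → (a :+ a) :* h :+ h :* (con 1ℚ :- a) :* con 1ℚ
                 := (con 1ℚ :+ a) :* h) ≈-refl a h ⟩
         (1ℝ + a) * h
           ≈⟨ 1+a*h ⟩
         1ℝ ∎)
     , ≤-trans (≤-reflexive (0≤⇒∣x∣≈x 0≤h)) (≤-by (0≤* (0≤* 0≤h 0≤w) (≤⇒0≤ r≤a)) (begin-equality
         w                 ≈⟨ R.*-identityˡ w ⟨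
         1ℝ * w            ≈⟨ *-cong 1+a*h ≈-refl ⟨
         ((1ℝ + a) * h) * w
           ≈⟨ solve 4 (λ a r h w → (con 1ℚ :+ a) :* h :* w
                 := h :* ((con 1ℚ :+ r) :* w) :+ h :* w :* (a :- r)) ≈-refl a r h w ⟩
         h * ((1ℝ + r) * w) + (h * w) * (a + - r)
           ≈⟨ +-cong (≈-trans (*-cong ≈-refl rw) (R.*-identityʳ h)) ≈-refl ⟩
         h + (h * w) * (a + - r) ∎))

  -- a - r = (a² - r²)/(a + r); the strict hypothesis makes a + r invertible.
  sq≥⇒≥ : ∀ {a} → r * r ≤ a * a → - r < a → r ≤ a
  sq≥⇒≥ {a} rr≤aa -r<a =
    let i , a+r*i , 0≤i = inverse (<⇒0< -r<a)
    in ≤-by (0≤* (≤⇒0≤ rr≤aa) 0≤i) (begin-equality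
         a            ≈⟨ solve 2 (λ a r → a := r :+ con 1ℚ :* (a :- r)) ≈-refl a r ⟩
         r + 1ℝ * (a + - r)  ≈⟨ +-cong ≈-refl (*-cong a+r*i ≈-refl) ⟨
         r + ((a + - - r) * i) * (a + - r)
           ≈⟨ solve 3 (λ a r i → r :+ (a :- :- r) :* i :* (a :- r)
                 := r :+ (a :* a :- r :* r) :* i) ≈-refl a r i ⟩
         r + (a * a + - (r * r)) * i ∎)

  feedback-below : ∀ {a} → r ≤ - a → ∃ λ κ → feedback a κ ≈ 1ℝ × ∣ κ ∣ ≤ w
  feedback-below {a} r≤-a =
    let κ , eq , κ≤w = feedback-above r≤-a
    in - κ , ≈-trans (feedback-neg a κ) eq , ≤-trans (≤-reflexive (∣-∣ κ)) κ≤w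
    where
    feedback-neg : ∀ a κ → feedback a (- κ) ≈ feedback (- a) κ
    feedback-neg = solve 2 (λ a κ → (a :+ a) :* :- κ :+ :- κ :* :- κ :* (con 1ℚ :- a :* a)
                  := (:- a :+ :- a) :* κ :+ κ :* κ :* (con 1ℚ :- :- a :* :- a)) ≈-refl

  -r<r : - r < r
  -r<r = <-by (<-≤-trans 0<r (≤-by 0≤r ≈-refl)) (solve 1 (λ r → r := :- r :+ (r :+ r)) ≈-refl r)

  -- A number with |a| ≥ r > 0 has a computable sign: cotransitivity of -r < r at `a` gives -r < a
  -- or a < r, and the inequality of squares sharpens these to r ≤ a or r ≤ -a.
  feedback-exists : ∀ {a} → r * r ≤ a * a → ∃ λ κ → feedback a κ ≈ 1ℝ × ∣ κ ∣ ≤ w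
  feedback-exists {a} rr≤aa =
    [ (λ -r<a → feedback-above (sq≥⇒≥ rr≤aa -r<a)) , (λ a<r → feedback-below (r≤-a a<r)) ]′
      (<-cotrans -r<r a)
    where
    r≤-a : a < r → r ≤ - a
    r≤-a a<r = sq≥⇒≥
      (≤-trans rr≤aa (≤-reflexive (solve 1 (λ a → a :* a := :- a :* :- a) ≈-refl a)))
      (<-by (<⇒0< a<r) (solve 2 (λ a r → :- a := :- r :+ (r :- a)) ≈-refl a r))

-- In the reductions `r` stays 1/√N while the order drops; the change of scale to the final order is
-- accounted for once, by `tolerance`.
EntriesNear : ∀ {n} → ℝ → ℝ → SquareMatrix ℝ n → Set
EntriesNear r e U = ∀ i j → (1ℝ + - e) * r ≤ ∣ U i j ∣ × ∣ U i j ∣ ≤ (1ℝ + e) * r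

EntriesNear-weaken : ∀ {n} {r e e′} {U : SquareMatrix ℝ n} → 0ℝ ≤ r → e ≤ e′ →
                     EntriesNear r e U → EntriesNear r e′ U
EntriesNear-weaken {r = r} {e} {e′} 0≤r e≤e′ near i j =
  let lower , upper = near i j
      0≤ = 0≤* (≤⇒0≤ e≤e′) 0≤r
  in ≤-trans (≤-by 0≤ (solve 3 (λ e f r → (con 1ℚ :- e) :* r
        := (con 1ℚ :- f) :* r :+ (f :- e) :* r) ≈-refl e e′ r)) lower
   , ≤-trans upper (≤-by 0≤ (solve 3 (λ e f r → (con 1ℚ :+ f) :* r
         := (con 1ℚ :+ e) :* r :+ (f :- e) :* r) ≈-refl e e′ r))

-- The correction satisfies |κcb| ≤ w((1+e)r)² = rw(1+e)² · r. The lower bound is the triangle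
-- inequality for d = (d - y) + y.
reduce-near : ∀ {n} {r w e κ : ℝ} {U : SquareMatrix ℝ (suc n)} → EntriesNear r e U → ∀ j → ∣ κ ∣ ≤ w →
  EntriesNear r (e + (r * w) * ((1ℝ + e) * (1ℝ + e))) (reduce U j κ)
reduce-near {r = r} {w} {e} {κ} {U} near j κ≤w i l =
    ≤-by (≤⇒0≤ (begin
      (1ℝ + - e) * r     ≤⟨ proj₁ (near (suc i) (punchIn j l)) ⟩
      ∣ d ∣              ≈⟨ ∣∣-cong (solve 2 (λ d y → d := (d :- y) :+ y) ≈-refl d y) ⟩
      ∣ (d + - y) + y ∣  ≤⟨ ∣+∣≤ (d + - y) y ⟩
      ∣ d + - y ∣ + ∣ y ∣  ≤⟨ +-mono-≤ (≤-reflexive ≈-refl) y≤ ⟩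
      ∣ d + - y ∣ + Y    ∎))
      (solve 4 (λ o e r w → o := (con 1ℚ :- (e :+ r :* w :* ((con 1ℚ :+ e) :* (con 1ℚ :+ e)))) :* r
         :+ (o :+ w :* ((con 1ℚ :+ e) :* r) :* ((con 1ℚ :+ e) :* r) :- (con 1ℚ :- e) :* r)) ≈-refl ∣ d + - y ∣ e r w)
  , (begin
      ∣ d + - y ∣          ≤⟨ ∣+∣≤ d (- y) ⟩
      ∣ d ∣ + ∣ - y ∣      ≈⟨ +-cong ≈-refl (∣-∣ y) ⟩
      ∣ d ∣ + ∣ y ∣        ≤⟨ +-mono-≤ (proj₂ (near (suc i) (punchIn j l))) y≤ ⟩
      (1ℝ + e) * r + Y
        ≈⟨ solve 3 (λ e r w → (con 1ℚ :+ e) :* r :+ w :* ((con 1ℚ :+ e) :* r) :* ((con 1ℚ :+ e) :* r)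
             := (con 1ℚ :+ (e :+ r :* w :* ((con 1ℚ :+ e) :* (con 1ℚ :+ e)))) :* r) ≈-refl e r w ⟩
      (1ℝ + (e + (r * w) * ((1ℝ + e) * (1ℝ + e)))) * r ∎)
  where
  d c b y Y : ℝ
  d = U (suc i) (punchIn j l)
  c = U (suc i) j
  b = U zero (punchIn j l)
  y = (κ * c) * b
  Y = (w * ((1ℝ + e) * r)) * ((1ℝ + e) * r)
  y≤ : ∣ y ∣ ≤ Y
  y≤ = begin
    ∣ (κ * c) * b ∣          ≈⟨ ∣*∣ (κ * c) b ⟩
    ∣ κ * c ∣ * ∣ b ∣
      ≤⟨ *-mono-≤ (0≤∣∣ (κ * c)) (0≤∣∣ b)
           (≤-trans (≤-reflexive (∣*∣ κ c)) (*-mono-≤ (0≤∣∣ κ) (0≤∣∣ c) κ≤w (proj₂ (near (suc i) j))))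
           (proj₂ (near zero (punchIn j l))) ⟩
    Y ∎

-- The scaled Hadamard matrix

sum-const : ∀ n c → sumℝ {n} (λ _ → c) ≈ fromℕ n * c
sum-const zero c = ≈-sym (R.zeroˡ c)
sum-const (suc n) c = begin-equality
  c + sumℝ {n} (λ _ → c)  ≈⟨ +-cong ≈-refl (sum-const n c) ⟩
  c + fromℕ n * c         ≈⟨ solve 2 (λ n c → c :+ n :* c := (con 1ℚ :+ n) :* c) ≈-refl (fromℕ n) c ⟩
  (1ℝ + fromℕ n) * c      ≈⟨ *-cong (fromℕ-+ 1 n) ≈-refl ⟨
  fromℕ (suc n) * c       ∎

fromℤ-sum : ∀ {n} (f : Vector ℤ n) → fromℤ (sumℤ f) ≈ sumℝ (fromℤ ∘ f)
fromℤ-sum {zero}  f = ≈-refl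
fromℤ-sum {suc n} f = ≈-trans (fromℤ-+ (f zero) (sumℤ (f ∘ suc))) (+-cong ≈-refl (fromℤ-sum (f ∘ suc)))

scaled : ∀ {n} → ℝ → SquareMatrix ℤ n → SquareMatrix ℝ n
scaled r H i j = fromℤ (H i j) * r

module _ {m} {H : SquareMatrix ℤ m} (hadamard : IsHadamard H) where
  private module H = IsHadamard hadamard

  entry-sq : ∀ i j → fromℤ (H i j) * fromℤ (H i j) ≈ 1ℝ
  entry-sq i j with H i j | H.entries i j
  ... | _ | inj₁ refl = ≗⇒≈ λ _ → refl
  ... | _ | inj₂ refl = ≗⇒≈ λ _ → refl

  ∣entry∣ : ∀ i j → ∣ fromℤ (H i j) ∣ ≈ 1ℝ
  ∣entry∣ i j with H i j | H.entries i j
  ... | _ | inj₁ refl = ≗⇒≈ λ _ → refl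
  ... | _ | inj₂ refl = ≗⇒≈ λ _ → refl

  scaled-orthonormal : ∀ {r} → fromℕ m * (r * r) ≈ 1ℝ → RowsOrthonormal (scaled r H)
  scaled-orthonormal {r} mrr≈1 i j with i Fin.≟ j
  ... | yes refl = begin-equality
    scaled r H i · scaled r H i
      ≈⟨ (sum-cong-≋ λ l → ≈-trans
           (solve 2 (λ h r → h :* r :* (h :* r) := h :* h :* (r :* r)) ≈-refl (fromℤ (H i l)) r)
           (≈-trans (*-cong (entry-sq i l) ≈-refl) (R.*-identityˡ (r * r)))) ⟩
    sumℝ {m} (λ _ → r * r)  ≈⟨ sum-const m (r * r) ⟩
    fromℕ m * (r * r)       ≈⟨ mrr≈1 ⟩
    1ℝ                      ∎
  ... | no i≢j = begin-equality
    scaled r H i · scaled r H j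
      ≈⟨ (sum-cong-≋ λ l → ≈-trans
           (solve 3 (λ h k r → h :* r :* (k :* r)
                 := h :* k :* (r :* r)) ≈-refl (fromℤ (H i l)) (fromℤ (H j l)) r)
           (*-cong (≈-sym (fromℤ-* (H i l) (H j l))) ≈-refl)) ⟩
    sumℝ (λ l → fromℤ (H i l ℤ.* H j l) * (r * r))
      ≈⟨ *-distribʳ-sum (r * r) (λ l → fromℤ (H i l ℤ.* H j l)) ⟨
    sumℝ (λ l → fromℤ (H i l ℤ.* H j l)) * (r * r)
      ≈⟨ *-cong (fromℤ-sum (λ l → H i l ℤ.* H j l)) ≈-refl ⟨
    fromℤ (sumℤ (λ l → H i l ℤ.* H j l)) * (r * r)
      ≈⟨ *-cong (ι-cong (cong (ℚ._/ 1) (H.rows-orthogonal i j i≢j))) ≈-refl ⟩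
    0ℝ * (r * r)
      ≈⟨ R.zeroˡ (r * r) ⟩
    0ℝ ∎

  scaled-near : ∀ {r} → 0ℝ ≤ r → EntriesNear r 0ℝ (scaled r H)
  scaled-near {r} 0≤r i j =
      ≤-reflexive (≈-trans (solve 1 (λ r → (con 1ℚ :- con 0ℚ) :* r := r) ≈-refl r) (≈-sym ∣Hr∣≈r))
    , ≤-reflexive (≈-trans ∣Hr∣≈r (solve 1 (λ r → r := (con 1ℚ :+ con 0ℚ) :* r) ≈-refl r))
    where
    ∣Hr∣≈r : ∣ scaled r H i j ∣ ≈ r
    ∣Hr∣≈r = begin-equality
      ∣ fromℤ (H i j) * r ∣      ≈⟨ ∣*∣ (fromℤ (H i j)) r ⟩
      ∣ fromℤ (H i j) ∣ * ∣ r ∣  ≈⟨ *-cong (∣entry∣ i j) (0≤⇒∣x∣≈x 0≤r) ⟩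
      1ℝ * r                     ≈⟨ R.*-identityˡ r ⟩
      r                          ∎

-- From relative errors to an ε-Hadamard matrix

NearHadamard : ℕ → ℝ → ℝ → Set
NearHadamard n r e = ∃ λ (U : SquareMatrix ℝ n) → RowsOrthonormal U × EntriesNear r e U

-- If |u| ≥ (1 - e) r and k r² = 1 - τ, then r √k ≥ k r² gives
-- |u| √k ≥ (1 - τ)(1 - e).
tolerance : ℝ → ℝ → ℝ
tolerance τ e = 1ℝ + - ((1ℝ + - τ) * (1ℝ + - e))

module _ {k : ℕ} .{{k≢0 : NonZero k}} {r τ e : ℝ} (E T : ℚ)
         (0≤r : 0ℝ ≤ r) (krr : fromℕ k * (r * r) ≈ 1ℝ + - τ)
         (0≤τ : 0ℝ ≤ τ) (τ≤T : τ ≤ ι T) (T<1 : T ℚ.< 1ℚ)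
         (0≤e : 0ℝ ≤ e) (e≤E : e ≤ ι E) (E<1 : E ℚ.< 1ℚ)
  where

  private
    0≤1-e : 0ℝ ≤ 1ℝ + - e
    0≤1-e = ≤⇒0≤ (≤-trans e≤E (ι-mono-≤ (ℚ.<⇒≤ E<1)))

    y : ℝ
    y = r * √ k

    y² : y * y ≈ 1ℝ + - τ
    y² = begin-equality
      y * y                ≈⟨ solve 2 (λ r s → r :* s :* (r :* s)
            := s :* s :* (r :* r)) ≈-refl r (√ k) ⟩
      (√ k * √ k) * (r * r)  ≈⟨ *-cong (√-sq k) ≈-refl ⟩
      fromℕ k * (r * r)    ≈⟨ krr ⟩
      1ℝ + - τ             ∎

    0≤√k : 0ℝ ≤ √ k
    0≤√k = ≤-trans (0≤ι 1ℚ) (1≤√ k)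

    0≤y : 0ℝ ≤ y
    0≤y = 0≤* 0≤r 0≤√k

    y≤1 : y ≤ 1ℝ
    y≤1 = sq-cancel (0≤ι 1ℚ) (≤-trans (≤-reflexive y²)
      (≤-by 0≤τ (solve 1 (λ t → con 1ℚ :* con 1ℚ := con 1ℚ :- t :+ t) ≈-refl τ)))

    e≤tolerance : e ≤ tolerance τ e
    e≤tolerance = ≤-by (0≤* 0≤τ 0≤1-e)
      (solve 2 (λ t e → con 1ℚ :- (con 1ℚ :- t) :* (con 1ℚ :- e) := e :+ t :* (con 1ℚ :- e)) ≈-refl τ e)

    -- The difference from 1 is (1 - τ)(1 - e); the rational bounds `T` and `E` below 1 keep both
    -- factors away from 0 and so provide the gap.
    tolerance<1 : tolerance τ e < 1ℝ
    tolerance<1 = <-by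
      (<-≤-trans (0<* (<⇒0< (ι-mono-< T<1)) (<⇒0< (ι-mono-< E<1)))
        (*-mono-≤ (≤⇒0≤ (ι-mono-≤ (ℚ.<⇒≤ T<1))) (≤⇒0≤ (ι-mono-≤ (ℚ.<⇒≤ E<1)))
          (complement τ≤T) (complement e≤E)))
      (solve 2 (λ t e → con 1ℚ
            := con 1ℚ :- (con 1ℚ :- t) :* (con 1ℚ :- e) :+ (con 1ℚ :- t) :* (con 1ℚ :- e)) ≈-refl τ e)
      where
      complement : ∀ {x y} → x ≤ y → 1ℝ + - y ≤ 1ℝ + - x
      complement {x} {y} x≤y = ≤-by (≤⇒0≤ x≤y)
        (solve 2 (λ x y → con 1ℚ :- x := con 1ℚ :- y :+ (y :- x)) ≈-refl x y)

    -- With y = r√k and y² = 1 - τ ≤ 1, the upper side uses y ≤ 1 and costs only `e`, while the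
    -- lower side uses y ≥ y², which avoids a root of 1 - τ.
    ∣error∣≤ : ∀ {u} → (1ℝ + - e) * r ≤ u → u ≤ (1ℝ + e) * r → 0ℝ ≤ u →
               ∣ u * √ k + - 1ℝ ∣ ≤ tolerance τ e
    ∣error∣≤ {u} lower upper 0≤u = ∣∣-least
      (begin
        u * √ k + - 1ℝ
          ≤⟨ +-mono-≤ (*-mono-≤ 0≤u 0≤√k upper (≤-reflexive ≈-refl)) (≤-reflexive ≈-refl) ⟩
        ((1ℝ + e) * r) * √ k + - 1ℝ
          ≈⟨ +-cong (R.*-assoc (1ℝ + e) r (√ k)) ≈-refl ⟩
        (1ℝ + e) * y + - 1ℝ
          ≤⟨ +-mono-≤ (*-mono-≤ (0≤+ (0≤ι 1ℚ) 0≤e) 0≤y (≤-reflexive ≈-refl) y≤1) (≤-reflexive ≈-refl) ⟩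
        (1ℝ + e) * 1ℝ + - 1ℝ
          ≈⟨ solve 1 (λ e → (con 1ℚ :+ e) :* con 1ℚ :- con 1ℚ := e) ≈-refl e ⟩
        e
          ≤⟨ e≤tolerance ⟩
        tolerance τ e ∎)
      (≤-by (≤⇒0≤ (begin
        (1ℝ + - τ) * (1ℝ + - e)   ≈⟨ *-cong y² ≈-refl ⟨
        (y * y) * (1ℝ + - e)
          ≤⟨ ≤-by (0≤* (0≤* 0≤y (≤⇒0≤ y≤1)) 0≤1-e)
               (solve 2 (λ y e → (con 1ℚ :- e) :* y
                     := y :* y :* (con 1ℚ :- e) :+ y :* (con 1ℚ :- y) :* (con 1ℚ :- e)) ≈-refl y e) ⟩
        (1ℝ + - e) * y            ≈⟨ R.*-assoc (1ℝ + - e) r (√ k) ⟨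
        ((1ℝ + - e) * r) * √ k    ≤⟨ *-mono-≤ (0≤* 0≤1-e 0≤r) 0≤√k lower (≤-reflexive ≈-refl) ⟩
        u * √ k                   ∎))
        (solve 3 (λ t e v → con 1ℚ :- (con 1ℚ :- t) :* (con 1ℚ :- e)
            := :- (v :- con 1ℚ) :+ (v :- (con 1ℚ :- t) :* (con 1ℚ :- e))) ≈-refl τ e (u * √ k)))

  isEpsHadamard : ∀ {c} → tolerance τ e ≤ c → NearHadamard k r e →
    ∃ λ (ε : ℝ) → ∃ λ (O : SquareMatrix ℝ k) → IsEpsHadamard ε O × ε ≤ c
  isEpsHadamard tolerance≤c (U , orth , near) =
    maxℝ (λ i → maxℝ (λ j → ∣ err i j ∣)) , U , record
      { orthogonal   = isOrthogonal orth
      ; error        = err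
      ; entries      = entry
      ; ε-is-maximum = ≈-refl
      ; ε<1          = ≤-<-trans max≤ tolerance<1
      } , ≤-trans max≤ tolerance≤c
    where
    err : SquareMatrix ℝ k
    err i j = ∣ U i j ∣ * √ k + - 1ℝ
    entry : ∀ i j → ∣ U i j ∣ ≈ (1ℝ + err i j) /√ k
    entry i j = begin-equality
      ∣ U i j ∣                              ≈⟨ R.*-identityʳ ∣ U i j ∣ ⟨
      ∣ U i j ∣ * 1ℝ                         ≈⟨ *-cong ≈-refl (recip-inverse (√ k) (√-#0 k)) ⟨
      ∣ U i j ∣ * (√ k * recip (√ k) (√-#0 k))
        ≈⟨ solve 3 (λ u s q → u :* (s :* q)
              := (con 1ℚ :+ (u :* s :- con 1ℚ)) :* q) ≈-refl ∣ U i j ∣ (√ k) (recip (√ k) (√-#0 k)) ⟩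
      (1ℝ + err i j) /√ k                    ∎
    max≤ : maxℝ (λ i → maxℝ (λ j → ∣ err i j ∣)) ≤ tolerance τ e
    max≤ = maxℝ-least _ 0≤tolerance λ i → maxℝ-least _ 0≤tolerance λ j →
      ∣error∣≤ (proj₁ (near i j)) (proj₂ (near i j)) (0≤∣∣ (U i j))
      where
      0≤tolerance : 0ℝ ≤ tolerance τ e
      0≤tolerance = ≤-trans 0≤e e≤tolerance

-- One reduction turns relative error q g into at most nextError γ q * g
-- as long as g ≤ γ.
nextError : ℚ → ℚ → ℚ
nextError γ q = q ℚ.+ (1ℚ ℚ.+ q ℚ.* γ) ℚ.* (1ℚ ℚ.+ q ℚ.* γ)

-- Only inside the square is `g` replaced by `γ`. The outer factor `g` survives, so the error
-- remains a rational multiple of `g` and the final numerical conditions are decidable in ℚ.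
nextError-bound : ∀ γ q .{{_ : ℚ.NonNegative q}} {g} → 0ℝ ≤ g → g ≤ ι γ →
  let e = ι q * g in e + g * ((1ℝ + e) * (1ℝ + e)) ≤ ι (nextError γ q) * g
nextError-bound γ q {g} 0≤g g≤γ = begin
  ι q * g + g * ((1ℝ + ι q * g) * (1ℝ + ι q * g))
    ≤⟨ +-mono-≤ (≤-reflexive ≈-refl) (*-mono-≤ 0≤g (0≤* 0≤1+e 0≤1+e) (≤-reflexive ≈-refl)
         (*-mono-≤ 0≤1+e 0≤1+e e≤ e≤)) ⟩
  ι q * g + g * ((1ℝ + ι q * ι γ) * (1ℝ + ι q * ι γ))
    ≈⟨ solve 3 (λ q g γ → q :* g :+ g :* ((con 1ℚ :+ q :* γ) :* (con 1ℚ :+ q :* γ))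
         := (q :+ (con 1ℚ :+ q :* γ) :* (con 1ℚ :+ q :* γ)) :* g) ≈-refl (ι q) g (ι γ) ⟩
  (ι q + (1ℝ + ι q * ι γ) * (1ℝ + ι q * ι γ)) * g
    ≈⟨ *-cong (≗⇒≈ λ _ → refl) ≈-refl ⟩
  ι (nextError γ q) * g ∎
  where
  0≤1+e : 0ℝ ≤ 1ℝ + ι q * g
  0≤1+e = 0≤+ (0≤ι 1ℚ) (0≤* (0≤ι q) 0≤g)
  e≤ : 1ℝ + ι q * g ≤ 1ℝ + ι q * ι γ
  e≤ = +-mono-≤ (≤-reflexive ≈-refl) (*-mono-≤ (0≤ι q) 0≤g (≤-reflexive ≈-refl) g≤γ)

-- Iterating the reduction

module Reduction (N : ℕ) {r w : ℝ} (0≤r : 0ℝ ≤ r) (Nrr : fromℕ N * (r * r) ≈ 1ℝ)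
  (rw : (1ℝ + r) * w ≈ 1ℝ) (0≤w : 0ℝ ≤ w) (γ : ℚ) (g≤γ : r * w ≤ ι γ) where

  g : ℝ
  g = r * w

  0≤g : 0ℝ ≤ g
  0≤g = 0≤* 0≤r 0≤w

  0<r : 0ℝ < r
  0<r = inverse-pos 0≤r (≈-trans (solve 2 (λ r n → r :* (n :* r)
        := n :* (r :* r)) ≈-refl r (fromℕ N)) Nrr)

  reduce-at : ∀ {n e e′} (U : SquareMatrix ℝ (suc n)) → RowsOrthonormal U → EntriesNear r e U →
    e + g * ((1ℝ + e) * (1ℝ + e)) ≤ e′ →
    (∃ λ j → r * r ≤ U zero j * U zero j) → NearHadamard n r e′
  reduce-at {e = e} U orth near e≤e′ (j , pivot) =
    let κ , κ-eq , κ≤w = feedback-exists 0<r rw 0≤w pivot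
    in reduce U j κ , reduce-orthonormal {U = U} orth j κ κ-eq
     , EntriesNear-weaken {U = reduce U j κ} 0≤r e≤e′ (reduce-near {e = e} {U = U} near j κ≤w)

  -- The squares in a unit row sum to 1 = N r² > (n+1) r², the strict excess that `large-term`
  -- consumes.
  large-entry : ∀ {n} {U : SquareMatrix ℝ (suc n)} → RowsOrthonormal U → suc n ℕ.< N →
                ∃ λ j → r * r ≤ U zero j * U zero j
  large-entry {n} {U} orth n<N = large-term (λ j → U zero j * U zero j) (r * r) (<-≤-trans
    (<-by (0<* (<⇒0< (fromℕ-mono-< n<N)) (0<* 0<r 0<r))
      (solve 3 (λ m n s → n :* s := m :* s :+ (n :- m) :* s) ≈-refl (fromℕ (suc n)) (fromℕ N) (r * r)))
    (≤-reflexive (≈-trans Nrr (≈-sym (orth zero zero)))))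

  reduce-next : ∀ {n} q .{{_ : ℚ.NonNegative q}} → suc n ℕ.< N →
    NearHadamard (suc n) r (ι q * g) → NearHadamard n r (ι (nextError γ q) * g)
  reduce-next q n<N (U , orth , near) =
    reduce-at U orth near (nextError-bound γ q 0≤g g≤γ) (large-entry {U = U} orth n<N)

  -- At order N there is no strict excess, but every entry has square r², so the corner entry serves
  -- as pivot. From error 0 the new error is `g` itself.
  reduce-first : ∀ {n} (H : SquareMatrix ℤ (suc n)) → IsHadamard H → suc n ≡ N →
    NearHadamard n r (ι 1ℚ * g)
  reduce-first H hadamard refl = reduce-at (scaled r H)
    (scaled-orthonormal hadamard Nrr) (scaled-near hadamard 0≤r)
    (≤-reflexive (solve 1 (λ g → con 0ℚ :+ g :* ((con 1ℚ :+ con 0ℚ) :* (con 1ℚ :+ con 0ℚ))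
          := con 1ℚ :* g) ≈-refl g))
    (zero , ≤-reflexive (≈-sym (begin-equality
      (h * r) * (h * r)  ≈⟨ solve 2 (λ h r → h :* r :* (h :* r) := h :* h :* (r :* r)) ≈-refl h r ⟩
      (h * h) * (r * r)  ≈⟨ *-cong (entry-sq hadamard zero zero) ≈-refl ⟩
      1ℝ * (r * r)       ≈⟨ R.*-identityˡ (r * r) ⟩
      r * r              ∎)))
    where
    h : ℝ
    h = fromℤ (H zero zero)

-- Numerical bounds

1/√ : (k : ℕ) .{{_ : NonZero k}} → ℝ
1/√ k = recip (√ k) (√-#0 k)

0≤1/√ : ∀ k .{{_ : NonZero k}} → 0ℝ ≤ 1/√ k
0≤1/√ k = inverse-nonNeg (≤-trans (0≤ι 1ℚ) (1≤√ k)) (recip-inverse (√ k) (√-#0 k))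

1/√-sq : ∀ k .{{_ : NonZero k}} → fromℕ k * (1/√ k * 1/√ k) ≈ 1ℝ
1/√-sq k = begin-equality
  fromℕ k * (1/√ k * 1/√ k)      ≈⟨ *-cong (√-sq k) ≈-refl ⟨
  (√ k * √ k) * (1/√ k * 1/√ k)
    ≈⟨ solve 2 (λ s r → s :* s :* (r :* r) := s :* r :* (s :* r)) ≈-refl (√ k) (1/√ k) ⟩
  (√ k * 1/√ k) * (√ k * 1/√ k)  ≈⟨ *-cong inv inv ⟩
  1ℝ * 1ℝ                        ≈⟨ R.*-identityˡ 1ℝ ⟩
  1ℝ                             ∎
  where
  inv : √ k * 1/√ k ≈ 1ℝ
  inv = recip-inverse (√ k) (√-#0 k)

-- The hypotheses make η a bound for r = 1/√(4n) and γ = η/(1+η) one for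
-- g = r/(1+r).
module Construction (n : ℕ) .{{n≢0 : NonZero n}} (η γ : ℚ) .{{_ : ℚ.NonNegative η}}
         (1≤η²N : 1ℝ ≤ (ι η * ι η) * fromℕ (4 ℕ.* n))
         (γ≤1 : γ ℚ.≤ 1ℚ) (γ-eq : γ ≡ (1ℚ ℚ.- γ) ℚ.* η)
  where

  private
    N : ℕ
    N = 4 ℕ.* n

    instance
      N≢0 : NonZero N
      N≢0 = ℕ.m*n≢0 4 n

    r : ℝ
    r = 1/√ N

  0≤r : 0ℝ ≤ r
  0≤r = 0≤1/√ N

  private
    1/[1+r] : ∃ λ w → (1ℝ + r) * w ≈ 1ℝ × 0ℝ ≤ w
    1/[1+r] = inverse (<-≤-trans (ι-mono-< (ℚ.positive⁻¹ 1ℚ)) (≤-by {1ℝ} {1ℝ + r} 0≤r ≈-refl))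

    w : ℝ
    w = proj₁ 1/[1+r]

    rw : (1ℝ + r) * w ≈ 1ℝ
    rw = proj₁ (proj₂ 1/[1+r])

    0≤w : 0ℝ ≤ w
    0≤w = proj₂ (proj₂ 1/[1+r])

    r≤η : r ≤ ι η
    r≤η = sq-cancel (0≤ι η) (begin
      r * r          ≈⟨ R.*-identityˡ (r * r) ⟨
      1ℝ * (r * r)
        ≤⟨ *-mono-≤ (0≤ι 1ℚ) (0≤x² r) 1≤η²N (≤-reflexive ≈-refl) ⟩
      ((ι η * ι η) * fromℕ N) * (r * r)  ≈⟨ R.*-assoc (ι η * ι η) (fromℕ N) (r * r) ⟩
      (ι η * ι η) * (fromℕ N * (r * r))  ≈⟨ *-cong ≈-refl (1/√-sq N) ⟩
      (ι η * ι η) * 1ℝ                   ≈⟨ R.*-identityʳ (ι η * ι η) ⟩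
      ι η * ι η                          ∎)

    -- x/(1+x) is increasing: γ - g = w(1 - γ)(η - r), where `γ-eq` is γ = η/(1+η) cleared of its
    -- denominator.
    g≤γ : r * w ≤ ι γ
    g≤γ = ≤-by
      (0≤* 0≤w (0≤* (≤⇒0≤ (ι-mono-≤ γ≤1)) (≤⇒0≤ r≤η)))
      (begin-equality
        ι γ                      ≈⟨ R.*-identityʳ (ι γ) ⟨
        ι γ * 1ℝ                 ≈⟨ *-cong ≈-refl rw ⟨
        ι γ * ((1ℝ + r) * w)
          ≈⟨ solve 3 (λ c r w → c :* ((con 1ℚ :+ r) :* w)
                := w :* c :+ r :* w :- w :* ((con 1ℚ :- c) :* r)) ≈-refl (ι γ) r w ⟩
        w * ι γ + r * w + - (w * ((1ℝ + - ι γ) * r))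
          ≈⟨ +-cong (+-cong (*-cong ≈-refl γ≈) ≈-refl) ≈-refl ⟩
        w * ((1ℝ + - ι γ) * ι η) + r * w + - (w * ((1ℝ + - ι γ) * r))
          ≈⟨ solve 4 (λ c e r w → w :* ((con 1ℚ :- c) :* e) :+ r :* w :- w :* ((con 1ℚ :- c) :* r)
               := r :* w :+ w :* ((con 1ℚ :- c) :* (e :- r))) ≈-refl (ι γ) (ι η) r w ⟩
        r * w + w * ((1ℝ + - ι γ) * (ι η + - r)) ∎)
      where
      γ≈ : ι γ ≈ (1ℝ + - ι γ) * ι η
      γ≈ = ≈-trans (ι-cong γ-eq) (≗⇒≈ λ _ → refl)

  open Reduction N 0≤r (1/√-sq N) rw 0≤w γ g≤γ public
    using (g; 0≤g; reduce-first; reduce-next)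

  2/√4n≤1/√n : r + r ≤ 1/√ n
  2/√4n≤1/√n = sq-cancel (0≤1/√ n) (≤-reflexive (begin-equality
    (r + r) * (r + r)          ≈⟨ R.*-identityʳ ((r + r) * (r + r)) ⟨
    ((r + r) * (r + r)) * 1ℝ   ≈⟨ *-cong ≈-refl (1/√-sq n) ⟨
    ((r + r) * (r + r)) * (fromℕ n * (R′ * R′))
      ≈⟨ solve 3 (λ r n R → (r :+ r) :* (r :+ r) :* (n :* (R :* R))
            := con 4ℚ :* n :* (r :* r) :* (R :* R)) ≈-refl r (fromℕ n) R′ ⟩
    ((ι 4ℚ * fromℕ n) * (r * r)) * (R′ * R′)
      ≈⟨ *-cong (*-cong (fromℕ-* 4 n) ≈-refl) ≈-refl ⟨
    (fromℕ N * (r * r)) * (R′ * R′)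
      ≈⟨ *-cong (1/√-sq N) ≈-refl ⟩
    1ℝ * (R′ * R′)             ≈⟨ R.*-identityˡ (R′ * R′) ⟩
    R′ * R′                    ∎))
    where
    4ℚ : ℚ
    4ℚ = + 4 ℚ./ 1
    R′ : ℝ
    R′ = 1/√ n

  g≤r : g ≤ r
  g≤r = ≤-by (0≤* 0≤r 0≤g) (≈-trans (≈-sym (≈-trans (*-cong ≈-refl rw) (R.*-identityʳ r)))
    (solve 2 (λ r w → r :* ((con 1ℚ :+ r) :* w) := r :* w :+ r :* (r :* w)) ≈-refl r w))

  -- 1 - g = 1/(1+r), hence (1 - r²)(1 - g) = 1 - r. The exact value matters: ρ₁ = ½ leaves no
  -- slack, as r = ½/√n, whereas `tolerance-bound` with q = 1 and η = ½ gives only 3r/2.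
  tolerance-first : tolerance (fromℕ 1 * (r * r)) (ι 1ℚ * g) ≈ r
  tolerance-first = begin-equality
    tolerance (fromℕ 1 * (r * r)) (ι 1ℚ * g)
      ≈⟨ solve 2 (λ r w → con 1ℚ :- (con 1ℚ :- con 1ℚ :* (r :* r)) :* (con 1ℚ :- con 1ℚ :* (r :* w))
           := r :* r :+ r :* (con 1ℚ :- r) :* ((con 1ℚ :+ r) :* w)) ≈-refl r w ⟩
    r * r + (r * (1ℝ + - r)) * ((1ℝ + r) * w)
      ≈⟨ +-cong ≈-refl (*-cong ≈-refl rw) ⟩
    r * r + (r * (1ℝ + - r)) * 1ℝ
      ≈⟨ solve 1 (λ r → r :* r :+ r :* (con 1ℚ :- r) :* con 1ℚ := r) ≈-refl r ⟩
    r ∎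

  -- 1 - (1 - τ)(1 - e) ≤ e + τ, and then g ≤ r and τ = t r² ≤ t η r make the bound linear in `r`.
  tolerance-bound : ∀ t q .{{_ : ℚ.NonNegative q}} →
    tolerance (fromℕ t * (r * r)) (ι q * g) ≤ ι (q ℚ.+ + t ℚ./ 1 ℚ.* η) * r
  tolerance-bound t q = begin
    tolerance τ (ι q * g)
      ≤⟨ ≤-by (0≤* 0≤τ (0≤* (0≤ι q) 0≤g))
           (solve 2 (λ t e → e :+ t
                 := con 1ℚ :- (con 1ℚ :- t) :* (con 1ℚ :- e) :+ t :* e) ≈-refl τ (ι q * g)) ⟩
    ι q * g + fromℕ t * (r * r)
      ≤⟨ +-mono-≤ (*-mono-≤ (0≤ι q) 0≤g (≤-reflexive ≈-refl) g≤r)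
           (*-mono-≤ 0≤t (0≤x² r) (≤-reflexive ≈-refl) (*-mono-≤ 0≤r 0≤r r≤η (≤-reflexive ≈-refl))) ⟩
    ι q * r + fromℕ t * (ι η * r)
      ≈⟨ solve 4 (λ q t e r → q :* r :+ t :* (e :* r)
            := (q :+ t :* e) :* r) ≈-refl (ι q) (fromℕ t) (ι η) r ⟩
    (ι q + fromℕ t * ι η) * r
      ≈⟨ *-cong (≗⇒≈ λ _ → refl) ≈-refl ⟩
    ι (q ℚ.+ + t ℚ./ 1 ℚ.* η) * r ∎
    where
    τ : ℝ
    τ = fromℕ t * (r * r)
    0≤t : 0ℝ ≤ fromℕ t
    0≤t = fromℕ-mono-≤ {0} {t} ℕ.z≤n
    0≤τ : 0ℝ ≤ τ
    0≤τ = 0≤* 0≤t (0≤x² r)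

  -- Since k = N - t, k r² = 1 - t r², which fixes τ = t r². The target is phrased as 2ρ′r because
  -- 2r ≤ 1/√n.
  conclude : ∀ t k .{{_ : NonZero k}} q .{{_ : ℚ.NonNegative q}} ρ′ .{{_ : ℚ.NonNegative ρ′}} → N ≡ t ℕ.+ k →
    q ℚ.* γ ℚ.< 1ℚ → + t ℚ./ 1 ℚ.* (η ℚ.* η) ℚ.< 1ℚ →
    tolerance (fromℕ t * (r * r)) (ι q * g) ≤ ι (ρ′ ℚ.+ ρ′) * r →
    NearHadamard k r (ι q * g) →
    ∃ λ (ε : ℝ) → ∃ λ (O : SquareMatrix ℝ k) → IsEpsHadamard ε O × ε ≤ (ι ρ′ /√ n)
  conclude t k q ρ′ N≡t+k E<1 T<1 tol = isEpsHadamard (q ℚ.* γ) (+ t ℚ./ 1 ℚ.* (η ℚ.* η))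
    0≤r krr (0≤* 0≤t (0≤x² r))
    (≤-trans (*-mono-≤ 0≤t (0≤x² r) (≤-reflexive ≈-refl) (*-mono-≤ 0≤r 0≤r r≤η r≤η))
      (≤-reflexive (≗⇒≈ λ _ → refl)))
    T<1 (0≤* (0≤ι q) 0≤g)
    (≤-trans (*-mono-≤ (0≤ι q) 0≤g (≤-reflexive ≈-refl) g≤γ) (≤-reflexive (≗⇒≈ λ _ → refl)))
    E<1
    (begin
      tolerance (fromℕ t * (r * r)) (ι q * g)  ≤⟨ tol ⟩
      ι (ρ′ ℚ.+ ρ′) * r    ≈⟨ *-cong (≗⇒≈ {ι (ρ′ ℚ.+ ρ′)} {ι ρ′ + ι ρ′} λ _ → refl) ≈-refl ⟩
      (ι ρ′ + ι ρ′) * r    ≈⟨ solve 2 (λ p r → (p :+ p) :* r := p :* (r :+ r)) ≈-refl (ι ρ′) r ⟩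
      ι ρ′ * (r + r)       ≤⟨ *-mono-≤ (0≤ι ρ′) (0≤+ 0≤r 0≤r) (≤-reflexive ≈-refl) 2/√4n≤1/√n ⟩
      ι ρ′ /√ n            ∎)
    where
    0≤t : 0ℝ ≤ fromℕ t
    0≤t = fromℕ-mono-≤ {0} {t} ℕ.z≤n
    krr : fromℕ k * (r * r) ≈ 1ℝ + - (fromℕ t * (r * r))
    krr = begin-equality
      fromℕ k * (r * r)
        ≈⟨ solve 3 (λ t k s → k :* s := (t :+ k) :* s :- t :* s) ≈-refl (fromℕ t) (fromℕ k) (r * r) ⟩
      (fromℕ t + fromℕ k) * (r * r) + - (fromℕ t * (r * r))
        ≈⟨ +-cong (*-cong (fromℕ-+ t k) ≈-refl) ≈-refl ⟨
      fromℕ (t ℕ.+ k) * (r * r) + - (fromℕ t * (r * r))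
        ≈⟨ +-cong (*-cong (ι-cong (cong (λ m → + m ℚ./ 1) (sym N≡t+k))) ≈-refl) ≈-refl ⟩
      fromℕ N * (r * r) + - (fromℕ t * (r * r))
        ≈⟨ +-cong (1/√-sq N) ≈-refl ⟩
      1ℝ + - (fromℕ t * (r * r)) ∎

-- Choice of parameters and the three cases

4n-split : ∀ n t .{{_ : NonZero n}} → t ℕ.≤ 3 → 4 ℕ.* n ≡ t ℕ.+ (4 ℕ.* n ℕ.∸ t)
4n-split n t t≤3 = sym (ℕ.m+[n∸m]≡n (ℕ.≤-trans t≤3 (ℕ.≤-trans (ℕ.n≤1+n 3) (ℕ.m≤m*n 4 n))))

Hadamard : ℕ → Set
Hadamard m = ∃ λ (H : SquareMatrix ℤ m) → IsHadamard H

¼ ⅓ ⅕ : ℚ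
¼ = 1ℤ ℚ./ 4
⅓ = 1ℤ ℚ./ 3
⅕ = 1ℤ ℚ./ 5

1≤η²N : ∀ η m {N} → 1ℚ ℚ.≤ (η ℚ.* η) ℚ.* (+ m ℚ./ 1) → m ℕ.≤ N → 1ℝ ≤ (ι η * ι η) * fromℕ N
1≤η²N η m {N} 1≤ m≤N = begin
  1ℝ                       ≤⟨ ι-mono-≤ 1≤ ⟩
  ι ((η ℚ.* η) ℚ.* (+ m ℚ./ 1))  ≈⟨ ≗⇒≈ (λ _ → refl) ⟩
  (ι η * ι η) * fromℕ m
    ≤⟨ *-mono-≤ (0≤x² (ι η)) (fromℕ-mono-≤ {0} {m} ℕ.z≤n) (≤-reflexive ≈-refl) (fromℕ-mono-≤ m≤N) ⟩
  (ι η * ι η) * fromℕ N    ∎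

theorem2 : (t n : ℕ) .{{_ : NonZero n}} → 1 ℕ.≤ t → (t≤3 : t ℕ.≤ 3) →
    ∃ (λ (H : SquareMatrix ℤ (4 ℕ.* n)) → IsHadamard H) →
    (t ≡ 3 → 4 ℕ.≤ n) →
    ∃ λ (ε : ℝ) → ∃ λ (O : SquareMatrix ℝ (4 ℕ.* n ℕ.∸ t)) →
    IsEpsHadamard {{4n∸t-nonZero n t t≤3}} ε O × ε ≤ (ι (ρ t) /√ n)
theorem2 1 n _ t≤3 hadamard _ =
  -- The order is rewritten as an explicit successor, the shape `reduce-first` takes.
  let H , isHadamard = subst Hadamard N≡ hadamard
  in conclude 1 k 1ℚ ½ N≡
       (from-yes (1ℚ ℚ.* ⅓ ℚ.<? 1ℚ)) (from-yes (+ 1 ℚ./ 1 ℚ.* (½ ℚ.* ½) ℚ.<? 1ℚ))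
       (≤-reflexive (≈-trans tolerance-first (≈-sym (R.*-identityˡ _))))
       (reduce-first H isHadamard (sym N≡))
  where
  -- N ≥ 4 gives r ≤ ½, and ⅓ = ½/(1 + ½).
  open Construction n ½ ⅓ (1≤η²N ½ 4 (from-yes (1ℚ ℚ.≤? ½ ℚ.* ½ ℚ.* (+ 4 ℚ./ 1))) (ℕ.m≤m*n 4 n))
    (from-yes (⅓ ℚ.≤? 1ℚ)) refl
  k : ℕ
  k = 4 ℕ.* n ℕ.∸ 1
  instance
    k≢0 : NonZero k
    k≢0 = 4n∸t-nonZero n 1 t≤3
  N≡ : 4 ℕ.* n ≡ 1 ℕ.+ k
  N≡ = 4n-split n 1 t≤3
theorem2 2 n _ t≤3 hadamard _ =
  let H , isHadamard = subst Hadamard N≡ hadamard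
  in conclude 2 k q₂ (ρ 2) N≡
       -- q₂ = 1 + (4/3)² = 25/9, so q₂/3 = 25/27 < 1, and below q₂ + 1 = 34/9 ≤ 4 = 2ρ₂.
       (from-yes (q₂ ℚ.* ⅓ ℚ.<? 1ℚ)) (from-yes (+ 2 ℚ./ 1 ℚ.* (½ ℚ.* ½) ℚ.<? 1ℚ))
       (≤-trans (tolerance-bound 2 q₂) (*-mono-≤ (0≤ι (q₂ ℚ.+ + 2 ℚ./ 1 ℚ.* ½)) 0≤r
         (ι-mono-≤ (from-yes (q₂ ℚ.+ + 2 ℚ./ 1 ℚ.* ½ ℚ.≤? ρ 2 ℚ.+ ρ 2))) (≤-reflexive ≈-refl)))
       (reduce-next 1ℚ (ℕ.≤-reflexive (sym N≡))
         (reduce-first H isHadamard (sym N≡)))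
  where
  open Construction n ½ ⅓ (1≤η²N ½ 4 (from-yes (1ℚ ℚ.≤? ½ ℚ.* ½ ℚ.* (+ 4 ℚ./ 1))) (ℕ.m≤m*n 4 n))
    (from-yes (⅓ ℚ.≤? 1ℚ)) refl
  q₂ : ℚ
  q₂ = nextError ⅓ 1ℚ
  k : ℕ
  k = 4 ℕ.* n ℕ.∸ 2
  instance
    k≢0 : NonZero k
    k≢0 = 4n∸t-nonZero n 2 t≤3
  N≡ : 4 ℕ.* n ≡ 2 ℕ.+ k
  N≡ = 4n-split n 2 t≤3
theorem2 3 n _ t≤3 hadamard 4≤n =
  let H , isHadamard = subst Hadamard N≡ hadamard
  in conclude 3 k q₃ (ρ 3) N≡
       -- q₂ = 61/25 and q₃ is about 4.65, so q₃/5 is about 0.93, and q₃ + ¾ ≤ 8 = 2ρ₃.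
       (from-yes (q₃ ℚ.* ⅕ ℚ.<? 1ℚ)) (from-yes (+ 3 ℚ./ 1 ℚ.* (¼ ℚ.* ¼) ℚ.<? 1ℚ))
       (≤-trans (tolerance-bound 3 q₃) (*-mono-≤ (0≤ι (q₃ ℚ.+ + 3 ℚ./ 1 ℚ.* ¼)) 0≤r
         (ι-mono-≤ (from-yes (q₃ ℚ.+ + 3 ℚ./ 1 ℚ.* ¼ ℚ.≤? ρ 3 ℚ.+ ρ 3))) (≤-reflexive ≈-refl)))
       (reduce-next q₂ (ℕ.≤-trans (ℕ.n≤1+n (2 ℕ.+ k)) (ℕ.≤-reflexive (sym N≡)))
         (reduce-next 1ℚ (ℕ.≤-reflexive (sym N≡))
           (reduce-first H isHadamard (sym N≡))))
  where
  -- n ≥ 4 gives N ≥ 16 and r ≤ ¼, with ⅕ = ¼/(1 + ¼). The parameters ½ and ⅓ would bound the third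
  -- error only by about 2.16, too large for ε < 1.
  open Construction n ¼ ⅕ (1≤η²N ¼ 16 (from-yes (1ℚ ℚ.≤? ¼ ℚ.* ¼ ℚ.* (+ 16 ℚ./ 1))) (ℕ.*-monoʳ-≤ 4 (4≤n refl)))
    (from-yes (⅕ ℚ.≤? 1ℚ)) refl
  q₂ q₃ : ℚ
  q₂ = nextError ⅕ 1ℚ
  q₃ = nextError ⅕ q₂
  k : ℕ
  k = 4 ℕ.* n ℕ.∸ 3
  instance
    k≢0 : NonZero k
    k≢0 = 4n∸t-nonZero n 3 t≤3
  N≡ : 4 ℕ.* n ≡ 3 ℕ.+ k
  N≡ = 4n-split n 3 t≤3
theorem2 (suc (suc (suc (suc _)))) _ _ (s≤s (s≤s (s≤s ()))) _ _
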